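{- Let $n$ be a positive integer, $0\le n_0\le n$ an integer, $a=(a_1,\dots,a_n)$ a sequence of positive integers, $v=(v_1,\dots,v_n)\in\mathbb{Z}^n$, and $\lambda=(\lambda_1,\lambda_2,\dots)$ a partition with $|\lambda|=|v|$. For a subset $I\subseteq\{1,\dots,n\}$ let $p_I:=|\{i\in I: i\le n_0\}|$. Suppose there exists an integer $j$ with $0<j<n$ such that for every $j$-element subset $I=\{i_1,\dots,i_j\}\subseteq\{1,\dots,n\}$, \[ \sum_{k=1}^j v_{i_k}-p_I\,(n-n_0-j+p_I)<\sum_{k=1}^j\lambda_k . \] Then $D_{v,\lambda}(a;n,n_0)=0$.
   Context: For a nonnegative integer $k$, $(z)_k:=(z;q)_k=(1-z)(1-zq)\cdots(1-zq^{k-1})$. A partition is a weakly decreasing sequence of nonnegative integers with finitely many nonzero entries; $|v|$ denotes the sum of entries of a sequence $v$. The complete symmetric functions $h_r$ are defined by $\sum_{r\ge0}z^rh_r(X)=\prod_{x\in X}(1-zx)^{ -1}$, and $h_\lambda:=h_{\lambda_1}h_{\lambda_2}\cdots$. Let $X^{(a;n_0)}$ be the alphabet $\{x_iq^{k}: 1\le i\le n_0,\ 0\le k\le a_i-2\}\cup\{x_iq^k: n_0+1\le i\le n,\ 0\le k\le a_i-1\}$. With $\chi(i\le n_0)$ equal to $1$ if $i\le n_0$ and $0$ otherwise, define \[ D_{v,\lambda}(a;n,n_0):=\operatorname{CT}_{x}\; x^{ -v}\,h_\lambda\big(X^{(a;n_0)}\big)\prod_{1\le i<j\le n}(x_i/x_j)_{a_i-\chi(i\le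 n_0)}(qx_j/x_i)_{a_j-\chi(i\le n_0)}, \] where $x=(x_1,\dots,x_n)$, $x^{ -v}=x_1^{ -v_1}\cdots x_n^{ -v_n}$, and $\operatorname{CT}_x$ denotes the constant term in $x_1,\dots,x_n$ (coefficients in $\mathbb{Q}(q)$). Entries $\lambda_k$ with $k>\ell(\lambda)$ are $0$. -}

module Defs where

open import Data.Nat as ℕ using (ℕ; zero; suc; _∸_; _<ᵇ_)
open import Data.Integer as ℤ using (ℤ; +_; 0ℤ; 1ℤ)
open import Data.Bool using (Bool; true; false; if_then_else_)
open import Data.Fin using (Fin; toℕ)
open import Data.Fin.Subset using (Subset; ∣_∣)
open import Data.Fin.Subset.Properties using (_∈?_)
open import Data.List as List using (List; []; _∷_; _++_; allFin; concatMap; take; upTo; foldr)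
open import Data.Nat.ListAction using () renaming (sum to sumℕ)
open import Data.List.Relation.Unary.Linked using (Linked)
open import Data.Vec as Vec using (Vec; replicate; zipWith; updateAt; lookup)
open import Data.Vec.Properties using (≡-dec)
open import Data.Product using (_×_; _,_)
open import Relation.Nullary using (yes; no)
open import Relation.Nullary.Decidable using (⌊_⌋)

-- Polynomials in q and Laurent polynomials in x₁,…,xₙ with integer
-- coefficients, represented (non-normalised) as finite lists of terms
--   c · q^m · x^e   (c ∈ ℤ, m ∈ ℕ, e ∈ ℤⁿ).
-- Coefficients are extracted by summing over all matching terms, so the
-- representation need not be normalised.

record Term (n : ℕ) : Set where
  constructor term
  field
    coef : ℤ
    qexp : ℕ
    xexp : Vec ℤ n

Poly : ℕ → Set
Poly n = List (Term n)

-- a monomial  q^m x^e  (coefficient 1)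
Mono : ℕ → Set
Mono n = ℕ × Vec ℤ n

module _ {n : ℕ} where

  zeroP : Poly n
  zeroP = []

  oneP : Poly n
  oneP = term 1ℤ 0 (replicate n 0ℤ) ∷ []

  _+P_ : Poly n → Poly n → Poly n
  _+P_ = _++_

  mulT : Term n → Term n → Term n
  mulT (term c m e) (term d k f) = term (c ℤ.* d) (m ℕ.+ k) (zipWith ℤ._+_ e f)

  _*P_ : Poly n → Poly n → Poly n
  P *P Q = concatMap (λ s → List.map (mulT s) Q) P

  negP : Poly n → Poly n
  negP = List.map (λ { (term c m e) → term (ℤ.- c) m e })

  monoP : Mono n → Poly n
  monoP (m , e) = term 1ℤ m e ∷ []

  mulMono : Mono n → Mono n → Mono n
  mulMono (m , e) (k , f) = (m ℕ.+ k , zipWith ℤ._+_ e f)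

  qpow : ℕ → Mono n
  qpow k = (k , replicate n 0ℤ)

  prodP : List (Poly n) → Poly n
  prodP = foldr _*P_ oneP

  sumP : List (Poly n) → Poly n
  sumP = foldr _+P_ zeroP

  powP : Poly n → ℕ → Poly n
  powP P zero    = oneP
  powP P (suc k) = P *P powP P k

  qPoch : Mono n → ℕ → Poly n
  qPoch z k = prodP (List.map (λ t → oneP +P negP (monoP (mulMono z (qpow t)))) (upTo k))

  -- complete homogeneous symmetric function h_r of a finite alphabet
  -- (a list of monomials): the coefficient of z^r in ∏_{y∈Y} 1/(1-zy),
  -- i.e.  h_r(y ∷ Y) = Σ_{s=0}^{r} y^s h_{r-s}(Y),  h_r([]) = [r = 0].
  h : ℕ → List (Mono n) → Poly n
  h zero    []      = oneP
  h (suc r) []      = zeroP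
  h r       (y ∷ Y) = sumP (List.map (λ s → powP (monoP y) s *P h (r ∸ s) Y) (upTo (suc r)))

  hλ : List ℕ → List (Mono n) → Poly n
  hλ λs Y = prodP (List.map (λ r → h r Y) λs)

  coeff : ℕ → Vec ℤ n → Poly n → ℤ
  coeff m v [] = 0ℤ
  coeff m v (term c k e ∷ P) with m ℕ.≟ k | ≡-dec ℤ._≟_ v e
  ... | yes _ | yes _ = c ℤ.+ coeff m v P
  ... | _     | _     = coeff m v P

  unitV : Fin n → Vec ℤ n
  unitV i = updateAt (replicate n 0ℤ) i (λ _ → 1ℤ)

  xM : Fin n → Mono n
  xM i = (0 , unitV i)

  ratio : Fin n → Fin n → Mono n
  ratio i j = (0 , zipWith ℤ._-_ (unitV i) (unitV j))

-- Data of the theorem.  Indices i ∈ Fin n are 0-based, so the paper's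
-- "i ≤ n₀" (1-based) is  toℕ i < n₀.

χ : ℕ → {n : ℕ} → Fin n → ℕ
χ n₀ i = if toℕ i <ᵇ n₀ then 1 else 0

alphabet : {n : ℕ} → ℕ → Vec ℕ n → List (Mono n)
alphabet {n} n₀ a =
  concatMap (λ i → List.map (λ k → mulMono (xM i) (qpow k)) (upTo (lookup a i ∸ χ n₀ i)))
            (allFin n)

kernel : {n : ℕ} → ℕ → Vec ℕ n → Poly n
kernel {n} n₀ a =
  prodP (concatMap (λ i → concatMap (λ j →
           if toℕ i <ᵇ toℕ j
           then (qPoch (ratio i j) (lookup a i ∸ χ n₀ i)
                  *P qPoch (mulMono (qpow 1) (ratio j i)) (lookup a j ∸ χ n₀ i)) ∷ []
           else []) (allFin n)) (allFin n))

-- the polynomial  h_λ(X^{(a;n₀)}) · kernel ; D_{v,λ}(a;n,n₀) is the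
-- coefficient of x^v in it (a polynomial in q).
integrand : {n : ℕ} → ℕ → Vec ℕ n → List ℕ → Poly n
integrand n₀ a λs = hλ λs (alphabet n₀ a) *P kernel n₀ a

-- D_{v,λ}(a;n,n₀) = 0 in ℚ(q): all its q-coefficients vanish
DVanishes : {n : ℕ} → ℕ → Vec ℕ n → Vec ℤ n → List ℕ → Set
DVanishes n₀ a v λs = ∀ (m : ℕ) → coeff m v (integrand n₀ a λs) Relation.Binary.PropositionalEquality.≡ 0ℤ
  where import Relation.Binary.PropositionalEquality

-- partitions: weakly decreasing lists of naturals (trailing zeros allowed)
IsPartition : List ℕ → Set
IsPartition = Linked ℕ._≥_

sizeℕ : List ℕ → ℕ
sizeℕ = sumℕ

sizeℤ : {n : ℕ} → Vec ℤ n → ℤ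
sizeℤ v = Vec.foldr _ ℤ._+_ 0ℤ v

sumOver : {n : ℕ} → Subset n → Vec ℤ n → ℤ
sumOver {n} I v = List.foldr ℤ._+_ 0ℤ
  (List.map (λ i → if ⌊ i ∈? I ⌋ then lookup v i else 0ℤ) (allFin n))

pI : {n : ℕ} → ℕ → Subset n → ℕ
pI {n} n₀ I = sumℕ
  (List.map (λ i → if ⌊ i ∈? I ⌋ then χ n₀ i else 0) (allFin n))

-- λ₁ + ⋯ + λ_j (entries beyond the length are 0)
partialSum : ℕ → List ℕ → ℕ
partialSum j λs = sumℕ (take j λs)

module Submission where

-- Write h_λ = h_{λ₁} h_{λ₂} ⋯. As a function of its generating variable, h_{λ₁}(X) has simple
-- poles at the letters y = x_i q^k, and the kernel vanishes wherever letters of two different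
-- groups collide. Partial fractions therefore turn h_{λ₁}(X) times the kernel of all indices into
-- a sum over i of the kernel of the indices k ≠ i, multiplied by a Laurent polynomial whose
-- exponent of each x_k with k ≠ i is at most −ε i k, where ε i k = 1 if i ≤ n₀ < k and 0 otherwise.
-- Doing this for λ₁, …, λ_j selects a j-subset I such that every exponent v that occurs satisfies
-- Σ_{k ∉ I} v_k + Σ_{i ∈ I, k ∉ I} ε i k ≤ λ_{j+1} + λ_{j+2} + ⋯, which for |v| = |λ| is the negation
-- of the hypothesis for I.
-- Residues are avoided as follows: letters within a group differ by a factor q^k − q^l, which is
-- cancelled because exponents of q are bounded in a polynomial, and for one letter per group
-- the expansion is Lagrange's formula, whose denominators divide the kernel.

open import Data.Nat as ℕ using (ℕ; zero; suc)
import Data.Nat.Properties as ℕₚ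
open import Data.Integer as ℤ using (ℤ; +_; -[1+_])
import Data.Integer.Properties as ℤₚ
open import Data.List as List using (List; []; _∷_; _++_; length)
open import Data.List.Relation.Unary.All as All using (All; []; _∷_)
import Data.List.Relation.Unary.All.Properties as Allₚ
open import Data.List.Relation.Binary.Permutation.Propositional as Perm
  using (_↭_; prep; swap; ↭-sym)
open import Data.Maybe using (Maybe; just; nothing)
open import Data.Product using (_×_; _,_; Σ; ∃-syntax; proj₁; proj₂)
open import Algebra using (CommutativeRing)
open import Algebra.Solver.Ring.AlmostCommutativeRing using (_-Raw-AlmostCommutative⟶_; fromCommutativeRing)
open import Relation.Nullary using (¬_; yes; no; does; contradiction)
open import Relation.Binary.PropositionalEquality as ≡ using (_≡_)

-- Lists of terms are not normalised, so cancelling a scalar or passing along `_≈_` says nothing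
-- about single terms. Hence two kinds of exponent bound: `_⊢_≤_` inspects every listed term and
-- serves for products written out explicitly; `Supported` tests a polynomial by functionals,
-- respects `_≈_` and survives the cancellation of `q^k - q^l`. The exponent -ε arises as follows.
-- Reducing group k, of size b k, to one letter leaves x_k^(1 - b k), and Lagrange's formula brings
-- in a kernel quotient of degree at most b k - 1 - ε i k in x_k. The ε is there because for i ≤ n₀
-- < k the second q-factorial of the pair has one factor fewer than group k has letters. Two
-- obstacles shape the induction. The letters of a selected group i stay in the other complete
-- functions although the kernel no longer involves x_i; they move only the exponent of x_i, which
-- has ceased to count, so they are expanded away, which can only lower the degrees of those
-- functions. And a group with a_i = 1 and i ≤ n₀ has no letter, so the expansion never selects it;
-- when only such groups are left, any of them will do, their mutual kernel factors being trivial.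

module IntegerCoefficients {c ℓ} (R : CommutativeRing c ℓ) where

  open CommutativeRing R
  open import Algebra.Properties.Ring ring using (-0#≈0#; -‿distribˡ-*; -‿distribʳ-*; -‿involutive; -‿+-comm)
  open import Algebra.Properties.Semiring.Mult semiring using (×-homo-+; ×1-homo-*) renaming (_×_ to _⋆_)
  open import Relation.Binary.Reasoning.Setoid setoid

  ⟦_⟧ : ℤ → Carrier
  ⟦ + n ⟧      = n ⋆ 1#
  ⟦ -[1+ n ] ⟧ = - (suc n ⋆ 1#)

  cancel : ∀ a b d → (a + b) - (a + d) ≈ b - d
  cancel a b d = begin
    (a + b) - (a + d)       ≈⟨ +-cong (+-comm b a) (-‿+-comm a d) ⟨
    (b + a) + (- a + - d)   ≈⟨ +-assoc b a _ ⟩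
    b + (a + (- a + - d))   ≈⟨ +-cong refl (+-assoc a (- a) (- d)) ⟨
    b + ((a + - a) + - d)   ≈⟨ +-cong refl (+-cong (-‿inverseʳ a) refl) ⟩
    b + (0# + - d)          ≈⟨ +-cong refl (+-identityˡ _) ⟩
    b - d                   ∎

  ⟦⊖⟧ : ∀ m n → ⟦ m ℤ.⊖ n ⟧ ≈ m ⋆ 1# - n ⋆ 1#
  ⟦⊖⟧ m       zero    = sym (trans (+-cong refl -0#≈0#) (+-identityʳ _))
  ⟦⊖⟧ zero    (suc n) = sym (+-identityˡ _)
  ⟦⊖⟧ (suc m) (suc n) = begin
    ⟦ suc m ℤ.⊖ suc n ⟧                ≡⟨ ≡.cong ⟦_⟧ (ℤₚ.[1+m]⊖[1+n]≡m⊖n m n) ⟩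
    ⟦ m ℤ.⊖ n ⟧                        ≈⟨ ⟦⊖⟧ m n ⟩
    m ⋆ 1# - n ⋆ 1#                    ≈⟨ cancel 1# _ _ ⟨
    (1# + m ⋆ 1#) - (1# + n ⋆ 1#)      ∎

  ⟦+⟧ : ∀ i j → ⟦ i ℤ.+ j ⟧ ≈ ⟦ i ⟧ + ⟦ j ⟧
  ⟦+⟧ (+ m)      (+ n)      = ×-homo-+ 1# m n
  ⟦+⟧ (+ m)      -[1+ n ]   = ⟦⊖⟧ m (suc n)
  ⟦+⟧ -[1+ m ]   (+ n)      = trans (⟦⊖⟧ n (suc m)) (+-comm _ _)
  ⟦+⟧ -[1+ m ]   -[1+ n ]   = begin
    - (suc (suc (m ℕ.+ n)) ⋆ 1#)
      ≡⟨ ≡.cong (λ k → - (suc k ⋆ 1#)) (≡.sym (ℕₚ.+-suc m n)) ⟩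
    - ((suc m ℕ.+ suc n) ⋆ 1#)
      ≈⟨ -‿cong (×-homo-+ 1# (suc m) (suc n)) ⟩
    - (suc m ⋆ 1# + suc n ⋆ 1#)
      ≈⟨ -‿+-comm _ _ ⟨
    - (suc m ⋆ 1#) - suc n ⋆ 1# ∎

  ⟦-⟧ : ∀ i → ⟦ ℤ.- i ⟧ ≈ - ⟦ i ⟧
  ⟦-⟧ (+ zero)  = sym -0#≈0#
  ⟦-⟧ (+ suc n) = refl
  ⟦-⟧ -[1+ n ]  = sym (-‿involutive _)

  ⟦*⟧ : ∀ i j → ⟦ i ℤ.* j ⟧ ≈ ⟦ i ⟧ * ⟦ j ⟧
  ⟦*⟧-pos : ∀ m n → ⟦ + m ℤ.* + n ⟧ ≈ (m ⋆ 1#) * (n ⋆ 1#)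
  ⟦*⟧-pos m n = trans (reflexive (≡.cong ⟦_⟧ (≡.sym (ℤₚ.pos-* m n)))) (×1-homo-* m n)
  ⟦*⟧ (+ m)      (+ n)      = ⟦*⟧-pos m n
  ⟦*⟧ (+ m)      -[1+ n ]   = begin
    ⟦ + m ℤ.* -[1+ n ] ⟧          ≡⟨ ≡.cong ⟦_⟧ (≡.sym (ℤₚ.neg-distribʳ-* (+ m) (+ suc n))) ⟩
    ⟦ ℤ.- (+ m ℤ.* + suc n) ⟧     ≈⟨ trans (⟦-⟧ (+ m ℤ.* + suc n)) (-‿cong (⟦*⟧-pos m (suc n))) ⟩
    - ((m ⋆ 1#) * (suc n ⋆ 1#))   ≈⟨ -‿distribʳ-* _ _ ⟩
    (m ⋆ 1#) * - (suc n ⋆ 1#)     ∎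
  ⟦*⟧ -[1+ m ]   (+ n)      = begin
    ⟦ -[1+ m ] ℤ.* + n ⟧          ≡⟨ ≡.cong ⟦_⟧ (≡.sym (ℤₚ.neg-distribˡ-* (+ suc m) (+ n))) ⟩
    ⟦ ℤ.- (+ suc m ℤ.* + n) ⟧     ≈⟨ trans (⟦-⟧ (+ suc m ℤ.* + n)) (-‿cong (⟦*⟧-pos (suc m) n)) ⟩
    - ((suc m ⋆ 1#) * (n ⋆ 1#))   ≈⟨ -‿distribˡ-* _ _ ⟩
    - (suc m ⋆ 1#) * (n ⋆ 1#)     ∎
  ⟦*⟧ -[1+ m ]   -[1+ n ]   = begin
    ⟦ + suc m ℤ.* + suc n ⟧             ≈⟨ ⟦*⟧-pos (suc m) (suc n) ⟩
    (suc m ⋆ 1#) * (suc n ⋆ 1#)         ≈⟨ -‿involutive _ ⟨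
    - - ((suc m ⋆ 1#) * (suc n ⋆ 1#))   ≈⟨ -‿cong (-‿distribʳ-* _ _) ⟩
    - ((suc m ⋆ 1#) * - (suc n ⋆ 1#))   ≈⟨ -‿distribˡ-* _ _ ⟩
    - (suc m ⋆ 1#) * - (suc n ⋆ 1#)     ∎

  homomorphism : ℤ.+-*-rawRing -Raw-AlmostCommutative⟶ fromCommutativeRing R
  homomorphism = record
    { ⟦_⟧    = ⟦_⟧
    ; +-homo = ⟦+⟧
    ; *-homo = ⟦*⟧
    ; -‿homo = ⟦-⟧
    ; 0-homo = refl
    ; 1-homo = +-identityʳ 1#
    }

  -- Coefficients are compared in ℤ because the equality of the ring at hand need not be decidable:
  -- for Laurent polynomials it quantifies over all functionals.
  ⟦⟧-≟ : ∀ i j → Maybe (⟦ i ⟧ ≈ ⟦ j ⟧)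
  ⟦⟧-≟ i j with i ℤ.≟ j
  ... | yes i≡j = just (reflexive (≡.cong ⟦_⟧ i≡j))
  ... | no  _   = nothing

  open import Algebra.Solver.Ring ℤ.+-*-rawRing (fromCommutativeRing R) homomorphism ⟦⟧-≟ public
    using (solve; _:=_; _:+_; _:*_; _:-_; :-_)

-- Lagrange's expansion of complete symmetric functions

module _ {a} {A : Set a} where

  selections : List A → List (A × List A)
  selections []       = []
  selections (x ∷ xs) = (x , xs) ∷ List.map (λ (y , ys) → y , x ∷ ys) (selections xs)

  selections-↭ : ∀ xs → All (λ (y , ys) → xs ↭ y ∷ ys) (selections xs)
  selections-↭ []       = []
  selections-↭ (x ∷ xs) = Perm.refl ∷
    Allₚ.map⁺ (All.map (λ p → Perm.trans (prep x p) (swap x _ Perm.refl)) (selections-↭ xs))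

module RingLemmas {c ℓ} (R : CommutativeRing c ℓ) where

  open CommutativeRing R
  open IntegerCoefficients R using (solve; _:=_; _:+_; _:*_; _:-_; :-_)
  open import Relation.Binary.Reasoning.Setoid setoid

  module _ {a} {A : Set a} where

    ∏ ∑ : (A → Carrier) → List A → Carrier
    ∏ f xs = List.foldr _*_ 1# (List.map f xs)
    ∑ f xs = List.foldr _+_ 0# (List.map f xs)

    ∏-↭ : ∀ (f : A → Carrier) {xs ys} → xs ↭ ys → ∏ f xs ≈ ∏ f ys
    ∏-↭ f Perm.refl      = refl
    ∏-↭ f (prep x p)     = *-cong refl (∏-↭ f p)
    ∏-↭ f (swap x y p)   =
      trans (*-cong refl (*-cong refl (∏-↭ f p))) (lemma (f x) (f y) _)
      where
      lemma : ∀ a b c → a * (b * c) ≈ b * (a * c)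
      lemma = solve 3 (λ a b c →
        a :* (b :* c) := b :* (a :* c)) refl
    ∏-↭ f (Perm.trans p q) = trans (∏-↭ f p) (∏-↭ f q)

    ∏-++ : ∀ (f : A → Carrier) xs ys → ∏ f (xs ++ ys) ≈ ∏ f xs * ∏ f ys
    ∏-++ f []       ys = sym (*-identityˡ _)
    ∏-++ f (x ∷ xs) ys = trans (*-cong refl (∏-++ f xs ys)) (sym (*-assoc _ _ _))

    ∏-* : ∀ (f g : A → Carrier) xs → ∏ (λ x → f x * g x) xs ≈ ∏ f xs * ∏ g xs
    ∏-* f g []       = sym (*-identityˡ _)
    ∏-* f g (x ∷ xs) = trans (*-cong refl (∏-* f g xs)) (lemma (f x) (g x) _ _)
      where
      lemma : ∀ a b c d → a * b * (c * d) ≈ a * c * (b * d)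
      lemma = solve 4 (λ a b c d →
        a :* b :* (c :* d) := a :* c :* (b :* d)) refl

    ∑-cong : ∀ {f g : A → Carrier} {xs} → All (λ x → f x ≈ g x) xs → ∑ f xs ≈ ∑ g xs
    ∑-cong []       = refl
    ∑-cong (p ∷ ps) = +-cong p (∑-cong ps)

    ∑-linear : ∀ a b (f g : A → Carrier) xs →
      a * ∑ f xs + b * ∑ g xs ≈ ∑ (λ x → a * f x + b * g x) xs
    ∑-linear a b f g []       = trans (+-cong (zeroʳ a) (zeroʳ b)) (+-identityʳ _)
    ∑-linear a b f g (x ∷ xs) =
      trans (lemma a b (f x) (g x) _ _) (+-cong refl (∑-linear a b f g xs))
      where
      lemma : ∀ a b x y s t → a * (x + s) + b * (y + t) ≈ a * x + b * y + (a * s + b * t)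
      lemma = solve 6 (λ a b x y s t →
        a :* (x :+ s) :+ b :* (y :+ t) := a :* x :+ b :* y :+ (a :* s :+ b :* t)) refl

    ∑-*ʳ : ∀ (f : A → Carrier) c xs → ∑ f xs * c ≈ ∑ (λ x → f x * c) xs
    ∑-*ʳ f c []       = zeroˡ c
    ∑-*ʳ f c (x ∷ xs) = trans (lemma (f x) _ c) (+-cong refl (∑-*ʳ f c xs))
      where
      lemma : ∀ a b c → (a + b) * c ≈ a * c + b * c
      lemma = solve 3 (λ a b c →
        (a :+ b) :* c := a :* c :+ b :* c) refl

    ∑-map : ∀ {b} {B : Set b} (f : A → Carrier) (g : B → A) xs →
      ∑ f (List.map g xs) ≡ List.foldr _+_ 0# (List.map (λ x → f (g x)) xs)
    ∑-map f g []       = ≡.refl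
    ∑-map f g (x ∷ xs) = ≡.cong (λ s → f (g x) + s) (∑-map f g xs)

    ∏₂ : (A → A → Carrier) → List A → Carrier
    ∏₂ κ []       = 1#
    ∏₂ κ (x ∷ xs) = ∏ (κ x) xs * ∏₂ κ xs

    ∏₂-↭ : ∀ {κ : A → A → Carrier} → (∀ x y → κ x y ≈ κ y x) →
      ∀ {xs ys} → xs ↭ ys → ∏₂ κ xs ≈ ∏₂ κ ys
    ∏₂-↭ κ-sym Perm.refl        = refl
    ∏₂-↭ κ-sym (prep x p)       = *-cong (∏-↭ _ p) (∏₂-↭ κ-sym p)
    ∏₂-↭ {κ} κ-sym (swap x y p) =
      trans (*-cong (*-cong (κ-sym x y) (∏-↭ _ p)) (*-cong (∏-↭ _ p) (∏₂-↭ κ-sym p)))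
            (lemma (κ y x) _ _ _)
      where
      lemma : ∀ a b c d → a * b * (c * d) ≈ a * c * (b * d)
      lemma = solve 4 (λ a b c d →
        a :* b :* (c :* d) := a :* c :* (b :* d)) refl
    ∏₂-↭ κ-sym (Perm.trans p q) = trans (∏₂-↭ κ-sym p) (∏₂-↭ κ-sym q)

    ∏₂-++ : ∀ (κ : A → A → Carrier) xs ys →
      ∏₂ κ (xs ++ ys) ≈ ∏₂ κ xs * (∏ (λ x → ∏ (κ x) ys) xs * ∏₂ κ ys)
    ∏₂-++ κ []       ys = sym (trans (*-identityˡ _) (*-identityˡ _))
    ∏₂-++ κ (x ∷ xs) ys =
      trans (*-cong (∏-++ (κ x) xs ys) (∏₂-++ κ xs ys)) (lemma _ _ _ _ _)
      where
      lemma : ∀ a b c d e → a * b * (c * (d * e)) ≈ a * c * (b * d * e)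
      lemma = solve 5 (λ a b c d e →
        a :* b :* (c :* (d :* e)) := a :* c :* (b :* d :* e)) refl

  neg-diff-* : ∀ x y z → - ((x - y) * z) ≈ (y - x) * z
  neg-diff-* = solve 3 (λ x y z → :- ((x :- y) :* z) := (y :- x) :* z) refl

  -- Used with `e` = 1, `b` a power of q, and letters `y`, `y′`: the factor 1 - z of a q-shifted
  -- factorial, scaled by `b`, becomes the difference of two letters times the monomial `s`.
  binomial-factor : ∀ b e z y y′ s r → b * e ≈ y * s → b * z ≈ y′ * s →
    b * ((e - z) * r) ≈ (y - y′) * (s * r)
  binomial-factor b e z y y′ s r p q =
    trans (solve 4 (λ b e z r → b :* ((e :- z) :* r) := (b :* e :- b :* z) :* r) refl b e z r)
      (trans (*-cong (+-cong p (-‿cong q)) refl)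
        (solve 4 (λ y y′ s r → (y :* s :- y′ :* s) :* r := (y :- y′) :* (s :* r)) refl y y′ s r))

  neg-diff : ∀ x y z → (x - y) * z ≈ (y - x) * - z
  neg-diff = solve 3 (λ x y z → (x :- y) :* z := (y :- x) :* (:- z)) refl

  neg-neg : ∀ x → x ≈ - (- x)
  neg-neg = solve 1 (λ x → x := :- (:- x)) refl

  *-swap : ∀ x y z → x * (y * z) ≈ y * (x * z)
  *-swap = solve 3 (λ x y z → x :* (y :* z) := y :* (x :* z)) refl

  module _ {a b} {A : Set a} {B : Set b} (g : B → A) where

    ∏-map : ∀ (f : A → Carrier) xs → ∏ f (List.map g xs) ≡ ∏ (λ x → f (g x)) xs
    ∏-map f []       = ≡.refl
    ∏-map f (x ∷ xs) = ≡.cong (λ s → f (g x) * s) (∏-map f xs)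

    ∏₂-map : ∀ (κ : A → A → Carrier) xs → ∏₂ κ (List.map g xs) ≡ ∏₂ (λ x y → κ (g x) (g y)) xs
    ∏₂-map κ []       = ≡.refl
    ∏₂-map κ (x ∷ xs) = ≡.cong₂ _*_ (∏-map (κ (g x)) xs) (∏₂-map κ xs)

  *-interchange : ∀ x y z w → (x * y) * (z * w) ≈ (x * z) * (y * w)
  *-interchange = solve 4 (λ x y z w → (x :* y) :* (z :* w) := (x :* z) :* (y :* w)) refl

  pow : Carrier → ℕ → Carrier
  pow x zero    = 1#
  pow x (suc k) = x * pow x k

  -- Two letters `v`, `w` of one group share the unit x. Dividing the divided difference by x leaves
  -- the scalar q^k - q^l in front of `h`, in the shape that `torsion` cancels.
  pow-unit-step : ∀ {x x⁻¹ qk ql v w} h g₁ g₂ e → x * x⁻¹ ≈ 1# → v ≈ x * qk → w ≈ x * ql →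
    (v - w) * h ≈ g₁ - g₂ → g₁ * (x⁻¹ * e) - g₂ * (x⁻¹ * e) ≈ (qk - ql) * (h * e)
  pow-unit-step {x} {x⁻¹} {qk} {ql} {v} {w} h g₁ g₂ e inv v≈ w≈ eq = begin
    g₁ * (x⁻¹ * e) - g₂ * (x⁻¹ * e)
      ≈⟨ solve 4 (λ g₁ g₂ y e → g₁ :* (y :* e) :- g₂ :* (y :* e) := (g₁ :- g₂) :* (y :* e)) refl g₁ g₂ x⁻¹ e ⟩
    (g₁ - g₂) * (x⁻¹ * e)
      ≈⟨ *-cong eq refl ⟨
    (v - w) * h * (x⁻¹ * e)
      ≈⟨ *-cong (*-cong (+-cong v≈ (-‿cong w≈)) refl) refl ⟩
    (x * qk - x * ql) * h * (x⁻¹ * e)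
      ≈⟨ solve 6 (λ x y k l h e → (x :* k :- x :* l) :* h :* (y :* e) := (x :* y) :* ((k :- l) :* (h :* e)))
           refl x x⁻¹ qk ql h e ⟩
    (x * x⁻¹) * ((qk - ql) * (h * e))
      ≈⟨ trans (*-cong inv refl) (*-identityˡ _) ⟩
    (qk - ql) * (h * e) ∎

  *-move : ∀ x y z → (x * y) * z ≈ y * (x * z)
  *-move = solve 3 (λ x y z → (x :* y) :* z := y :* (x :* z)) refl

  *-collect : ∀ p r k m₁ m₂ h w₁ w₂ u →
    (p * (r * k)) * ((m₁ * m₂) * (h * ((w₁ * w₂) * u))) ≈ (p * ((m₁ * w₁) * (r * m₂))) * (h * (k * (w₂ * u)))
  *-collect = solve 9 (λ p r k m₁ m₂ h w₁ w₂ u →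
    (p :* (r :* k)) :* ((m₁ :* m₂) :* (h :* ((w₁ :* w₂) :* u)))
      := (p :* ((m₁ :* w₁) :* (r :* m₂))) :* (h :* (k :* (w₂ :* u)))) refl

  *-regroup : ∀ g m h k w u → g * (m * (h * (k * (w * u)))) ≈ (g * k) * (m * (h * (w * u)))
  *-regroup = solve 6 (λ g m h k w u → g :* (m :* (h :* (k :* (w :* u)))) := (g :* k) :* (m :* (h :* (w :* u)))) refl

  -- Complete functions enter only through their recurrence in the first letter, so that the same
  -- results apply to alphabets of monomials and to lists of items, which remember the group of a
  -- letter.
  module Complete {a} {A : Set a} (val : A → Carrier) (h : ℕ → List A → Carrier)
    (h-zero : ∀ xs → h 0 xs ≈ 1#)
    (h-nil : ∀ r → h (suc r) [] ≈ 0#)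
    (h-suc : ∀ r x xs → h (suc r) (x ∷ xs) ≈ h (suc r) xs + val x * h r (x ∷ xs)) where

    -- A form of the divided difference that stays in degree r on the right, so that induction on r
    -- needs nothing but `h-suc`; symmetry in the letters is not yet available.
    h-step : ∀ r x y xs →
      (val x - val y) * h r (x ∷ y ∷ xs) ≈ val x * h r (x ∷ xs) - val y * h r (y ∷ xs)
    h-step zero    x y xs = trans (*-cong refl (h-zero _)) (sym (trans
      (+-cong (*-cong refl (h-zero _)) (-‿cong (*-cong refl (h-zero _)))) (lemma (val x) (val y) 1#)))
      where
      lemma : ∀ a b e → a * e - b * e ≈ (a - b) * e
      lemma = solve 3 (λ a b e →
        a :* e :- b :* e := (a :- b) :* e) refl
    h-step (suc r) x y xs = begin
      (X - Y) * h (suc r) (x ∷ y ∷ xs)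
        ≈⟨ *-cong refl (h-suc r x (y ∷ xs)) ⟩
      (X - Y) * (h (suc r) (y ∷ xs) + X * h r (x ∷ y ∷ xs))
        ≈⟨ lemma₁ X Y _ _ ⟩
      (X - Y) * h (suc r) (y ∷ xs) + X * ((X - Y) * h r (x ∷ y ∷ xs))
        ≈⟨ +-cong (*-cong refl (h-suc r y xs)) (*-cong refl (h-step r x y xs)) ⟩
      (X - Y) * (h (suc r) xs + Y * h r (y ∷ xs)) + X * (X * h r (x ∷ xs) - Y * h r (y ∷ xs))
        ≈⟨ lemma₂ X Y _ _ _ ⟩
      X * (h (suc r) xs + X * h r (x ∷ xs)) - Y * (h (suc r) xs + Y * h r (y ∷ xs))
        ≈⟨ +-cong (*-cong refl (h-suc r x xs)) (-‿cong (*-cong refl (h-suc r y xs))) ⟨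
      X * h (suc r) (x ∷ xs) - Y * h (suc r) (y ∷ xs) ∎
      where
      X Y : Carrier
      X = val x
      Y = val y
      lemma₁ : ∀ X Y s t → (X - Y) * (s + X * t) ≈ (X - Y) * s + X * ((X - Y) * t)
      lemma₁ = solve 4 (λ X Y s t →
        (X :- Y) :* (s :+ X :* t) := (X :- Y) :* s :+ X :* ((X :- Y) :* t)) refl
      lemma₂ : ∀ X Y s t u →
        (X - Y) * (s + Y * u) + X * (X * t - Y * u) ≈ X * (s + X * t) - Y * (s + Y * u)
      lemma₂ = solve 5 (λ X Y s t u →
        (X :- Y) :* (s :+ Y :* u) :+ X :* (X :* t :- Y :* u) := X :* (s :+ X :* t) :- Y :* (s :+ Y :* u)) refl

    h-divided-difference : ∀ r x y xs →
      (val x - val y) * h r (x ∷ y ∷ xs) ≈ h (suc r) (x ∷ xs) - h (suc r) (y ∷ xs)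
    h-divided-difference r x y xs = trans (h-step r x y xs) (trans (lemma _ _ _)
      (+-cong (sym (h-suc r x xs)) (-‿cong (sym (h-suc r y xs)))))
      where
      lemma : ∀ s t u → t - u ≈ s + t - (s + u)
      lemma = solve 3 (λ s t u →
        t :- u := s :+ t :- (s :+ u)) refl

    -- Symmetry cannot be read off from `h-step` by dividing by x - y, which may be a zero divisor.
    -- Instead x h_r is split as (x - y) h_r + y h_r; `h-step` treats the first part and the
    -- induction hypothesis the second.
    h-swap : ∀ r x y xs → h r (x ∷ y ∷ xs) ≈ h r (y ∷ x ∷ xs)
    h-swap zero    x y xs = trans (h-zero _) (sym (h-zero _))
    h-swap (suc r) x y xs = begin
      h (suc r) (x ∷ y ∷ xs)
        ≈⟨ trans (h-suc r x _) (+-cong (h-suc r y xs) refl) ⟩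
      h (suc r) xs + Y * h r (y ∷ xs) + X * h r (x ∷ y ∷ xs)
        ≈⟨ lemma₁ X Y _ _ _ ⟩
      h (suc r) xs + (X - Y) * h r (x ∷ y ∷ xs) + (Y * h r (y ∷ xs) + Y * h r (x ∷ y ∷ xs))
        ≈⟨ +-cong (+-cong refl (h-step r x y xs)) (+-cong refl (*-cong refl (h-swap r x y xs))) ⟩
      h (suc r) xs + (X * h r (x ∷ xs) - Y * h r (y ∷ xs)) + (Y * h r (y ∷ xs) + Y * h r (y ∷ x ∷ xs))
        ≈⟨ lemma₂ X Y _ _ _ _ ⟩
      h (suc r) xs + X * h r (x ∷ xs) + Y * h r (y ∷ x ∷ xs)
        ≈⟨ trans (h-suc r y _) (+-cong (h-suc r x xs) refl) ⟨
      h (suc r) (y ∷ x ∷ xs) ∎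
      where
      X Y : Carrier
      X = val x
      Y = val y
      lemma₁ : ∀ X Y s t u → s + Y * t + X * u ≈ s + (X - Y) * u + (Y * t + Y * u)
      lemma₁ = solve 5 (λ X Y s t u →
        s :+ Y :* t :+ X :* u := s :+ (X :- Y) :* u :+ (Y :* t :+ Y :* u)) refl
      lemma₂ : ∀ X Y s t u w → s + (X * t - Y * u) + (Y * u + Y * w) ≈ s + X * t + Y * w
      lemma₂ = solve 6 (λ X Y s t u w →
        s :+ (X :* t :- Y :* u) :+ (Y :* u :+ Y :* w) := s :+ X :* t :+ Y :* w) refl

    h-∷-cong : ∀ x {xs ys} → (∀ r → h r xs ≈ h r ys) → ∀ r → h r (x ∷ xs) ≈ h r (x ∷ ys)
    h-∷-cong x eq zero    = trans (h-zero _) (sym (h-zero _))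
    h-∷-cong x eq (suc r) = trans (h-suc r x _)
      (trans (+-cong (eq (suc r)) (*-cong refl (h-∷-cong x eq r))) (sym (h-suc r x _)))

    h-↭ : ∀ {xs ys} → xs ↭ ys → ∀ r → h r xs ≈ h r ys
    h-↭ Perm.refl        r = refl
    h-↭ (prep x p)       r = h-∷-cong x (h-↭ p) r
    h-↭ (swap x y p)     r = trans (h-swap r x y _) (h-∷-cong y (h-∷-cong x (h-↭ p)) r)
    h-↭ (Perm.trans p q) r = trans (h-↭ p r) (h-↭ q r)

    h-singleton : ∀ r x → h r (x ∷ []) ≈ pow (val x) r
    h-singleton zero    x = h-zero _
    h-singleton (suc r) x = trans (h-suc r x []) (trans (+-cong (h-nil r) (*-cong refl (h-singleton r x)))
      (+-identityˡ _))

    module Lagrange {κ ρ : A → A → Carrier}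
      (κ-factor : ∀ x y → κ x y ≈ (val x - val y) * ρ x y)
      (ρ-antisym : ∀ x y → ρ x y ≈ - ρ y x) where

      -- Lagrange's term x^(r+m-1) / ∏ (x - y), with m letters in all and y running over the others,
      -- multiplied by `κ` over all pairs: the denominators turn each `κ x y` into `ρ x y`, and m -
      -- 1 is `length xs`.
      summand : ℕ → A × List A → Carrier
      summand r (x , xs) = pow (val x) (r ℕ.+ length xs) * (∏ (ρ x) xs * ∏₂ κ xs)

      -- Induction on the alphabet: the factor y - z of `κ y z` turns h_r into a difference of
      -- h_(r+1) over two alphabets with one letter less, and each is expanded by induction.
      lagrange : ∀ r x xs →
        h r (x ∷ xs) * ∏₂ κ (x ∷ xs) ≈ ∑ (summand r) (selections (x ∷ xs))
      lagrange r x []       = begin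
        h r (x ∷ []) * (1# * 1#)
          ≈⟨ *-cong (h-singleton r x) refl ⟩
        pow (val x) r * (1# * 1#)
          ≡⟨ ≡.cong (λ k → pow (val x) k * (1# * 1#)) (≡.sym (ℕₚ.+-identityʳ r)) ⟩
        pow (val x) (r ℕ.+ 0) * (1# * 1#)
          ≈⟨ +-identityʳ _ ⟨
        pow (val x) (r ℕ.+ 0) * (1# * 1#) + 0# ∎
      lagrange r y (z ∷ xs) = begin
        h r (y ∷ z ∷ xs) * ((κ y z * Ay) * (Az * K))
          ≈⟨ *-cong refl (*-cong (*-cong (κ-factor y z) refl) refl) ⟩
        h r (y ∷ z ∷ xs) * (((Y - Z) * ρ y z * Ay) * (Az * K))
          ≈⟨ lemma₁ (h r (y ∷ z ∷ xs)) (Y - Z) (ρ y z) Ay Az K ⟩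
        (Y - Z) * h r (y ∷ z ∷ xs) * (ρ y z * Ay * Az * K)
          ≈⟨ *-cong (h-divided-difference r y z xs) refl ⟩
        (h (suc r) (y ∷ xs) - h (suc r) (z ∷ xs)) * (ρ y z * Ay * Az * K)
          ≈⟨ lemma₂ (h (suc r) (y ∷ xs)) (h (suc r) (z ∷ xs)) (ρ y z) Ay Az K ⟩
        ρ y z * Az * (h (suc r) (y ∷ xs) * (Ay * K)) + - (ρ y z * Ay) * (h (suc r) (z ∷ xs) * (Az * K))
          ≈⟨ +-cong (*-cong refl (lagrange (suc r) y xs)) (*-cong refl (lagrange (suc r) z xs)) ⟩
        ρ y z * Az * (summand (suc r) (y , xs) + ∑ (summand (suc r)) (List.map (cons y) (selections xs)))
          + - (ρ y z * Ay) * (summand (suc r) (z , xs) + ∑ (summand (suc r)) (List.map (cons z) (selections xs)))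
          ≡⟨ ≡.cong₂ (λ s t → ρ y z * Az * (summand (suc r) (y , xs) + s)
                             + - (ρ y z * Ay) * (summand (suc r) (z , xs) + t))
               (∑-map (summand (suc r)) (cons y) (selections xs))
               (∑-map (summand (suc r)) (cons z) (selections xs)) ⟩
        ρ y z * Az * (summand (suc r) (y , xs) + Σy) + - (ρ y z * Ay) * (summand (suc r) (z , xs) + Σz)
          ≈⟨ lemma₃ (ρ y z * Az) (ρ y z * Ay) _ _ _ _ ⟩
        ρ y z * Az * summand (suc r) (y , xs)
          + (- (ρ y z * Ay) * summand (suc r) (z , xs) + (ρ y z * Az * Σy + - (ρ y z * Ay) * Σz))
          ≈⟨ +-cong first (+-cong second (trans
               (∑-linear (ρ y z * Az) (- (ρ y z * Ay)) (λ s → summand (suc r) (cons y s))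
                  (λ s → summand (suc r) (cons z s)) (selections xs))
               (∑-cong (All.map (λ {s} → rest s) (selections-↭ xs))))) ⟩
        summand r (y , z ∷ xs)
          + (summand r (z , y ∷ xs) + ∑ (λ s → summand r (cons y (cons z s))) (selections xs))
          ≡⟨ ≡.cong (λ s → summand r (y , z ∷ xs) + (summand r (z , y ∷ xs) + s))
               (≡.sym (≡.trans (∑-map (summand r) (cons y) (List.map (cons z) (selections xs)))
                 (∑-map (λ s → summand r (cons y s)) (cons z) (selections xs)))) ⟩
        ∑ (summand r) (selections (y ∷ z ∷ xs)) ∎
        where
        Y Z Ay Az K Σy Σz : Carrier
        Y = val y
        Z = val z
        Ay = ∏ (κ y) xs
        Az = ∏ (κ z) xs
        K = ∏₂ κ xs
        cons : A → A × List A → A × List A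
        cons x (u , s) = u , x ∷ s
        Σy = ∑ (λ s → summand (suc r) (cons y s)) (selections xs)
        Σz = ∑ (λ s → summand (suc r) (cons z s)) (selections xs)
        lemma₁ : ∀ h d ρ a b k → h * ((d * ρ * a) * (b * k)) ≈ d * h * (ρ * a * b * k)
        lemma₁ = solve 6 (λ h d ρ a b k →
          h :* ((d :* ρ :* a) :* (b :* k)) := d :* h :* (ρ :* a :* b :* k)) refl
        lemma₂ : ∀ s t ρ a b k →
          (s - t) * (ρ * a * b * k) ≈ ρ * b * (s * (a * k)) + - (ρ * a) * (t * (b * k))
        lemma₂ = solve 6 (λ s t ρ a b k →
          (s :- t) :* (ρ :* a :* b :* k) := ρ :* b :* (s :* (a :* k)) :+ :- (ρ :* a) :* (t :* (b :* k))) refl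
        lemma₃ : ∀ a b s t u w → a * (s + u) + - b * (t + w) ≈ a * s + (- b * t + (a * u + - b * w))
        lemma₃ = solve 6 (λ a b s t u w →
          a :* (s :+ u) :+ :- b :* (t :+ w) := a :* s :+ (:- b :* t :+ (a :* u :+ :- b :* w))) refl
        power : ∀ u k → pow (val u) (suc r ℕ.+ k) ≈ pow (val u) (r ℕ.+ suc k)
        power u k = reflexive (≡.cong (pow (val u)) (≡.sym (ℕₚ.+-suc r k)))
        first : ρ y z * Az * summand (suc r) (y , xs) ≈ summand r (y , z ∷ xs)
        first = trans (*-cong refl (*-cong (power y (length xs)) refl)) (lemma (ρ y z) Az _ _ _)
          where
          lemma : ∀ ρ a p s k → ρ * a * (p * (s * k)) ≈ p * ((ρ * s) * (a * k))
          lemma = solve 5 (λ ρ a p s k →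
            ρ :* a :* (p :* (s :* k)) := p :* ((ρ :* s) :* (a :* k))) refl
        second : - (ρ y z * Ay) * summand (suc r) (z , xs) ≈ summand r (z , y ∷ xs)
        second = trans (*-cong refl (*-cong (power z (length xs)) refl)) (trans (lemma (ρ y z) Ay _ _ _)
          (*-cong refl (*-cong (*-cong (sym (ρ-antisym z y)) refl) refl)))
          where
          lemma : ∀ ρ a p s k → - (ρ * a) * (p * (s * k)) ≈ p * ((- ρ * s) * (a * k))
          lemma = solve 5 (λ ρ a p s k →
            :- (ρ :* a) :* (p :* (s :* k)) := p :* ((:- ρ :* s) :* (a :* k))) refl
        κ-factor′ : ∀ x u → κ x u ≈ (val u - val x) * ρ u x
        κ-factor′ x u = trans (κ-factor x u) (trans (*-cong refl (ρ-antisym x u)) (lemma _ _ _))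
          where
          lemma : ∀ a b ρ → (a - b) * - ρ ≈ (b - a) * ρ
          lemma = solve 3 (λ a b ρ →
            (a :- b) :* :- ρ := (b :- a) :* ρ) refl
        -- Both expansions contain a term selecting u. They combine by (u - z) - (u - y) = y - z,
        -- which together with `ρ y z` restores the missing factor `κ y z`.
        rest : ∀ s → xs ↭ proj₁ s ∷ proj₂ s →
          ρ y z * Az * summand (suc r) (cons y s) + - (ρ y z * Ay) * summand (suc r) (cons z s)
            ≈ summand r (cons y (cons z s))
        rest (u , s) p = begin
          ρ y z * Az * (pow U (suc r ℕ.+ suc (length s)) * (ρ u y * D * (By * Ks)))
            + - (ρ y z * Ay) * (pow U (suc r ℕ.+ suc (length s)) * (ρ u z * D * (Bz * Ks)))
            ≈⟨ +-cong
                 (*-cong (*-cong refl (trans (∏-↭ (κ z) p) (*-cong (κ-factor′ z u) refl)))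
                         (*-cong (power u (suc (length s))) refl))
                 (*-cong (-‿cong (*-cong refl (trans (∏-↭ (κ y) p) (*-cong (κ-factor′ y u) refl))))
                         (*-cong (power u (suc (length s))) refl)) ⟩
          ρ y z * ((U - Z) * ρ u z * Bz) * (P * (ρ u y * D * (By * Ks)))
            + - (ρ y z * ((U - Y) * ρ u y * By)) * (P * (ρ u z * D * (Bz * Ks)))
            ≈⟨ lemma Y Z U (ρ y z) (ρ u y) (ρ u z) By Bz P D Ks ⟩
          P * ((ρ u y * (ρ u z * D)) * (((Y - Z) * ρ y z * By) * (Bz * Ks)))
            ≈⟨ *-cong refl (*-cong refl (*-cong (*-cong (κ-factor y z) refl) refl)) ⟨
          P * ((ρ u y * (ρ u z * D)) * ((κ y z * By) * (Bz * Ks))) ∎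
          where
          U By Bz P D Ks : Carrier
          U = val u
          By = ∏ (κ y) s
          Bz = ∏ (κ z) s
          P = pow U (r ℕ.+ suc (suc (length s)))
          D = ∏ (ρ u) s
          Ks = ∏₂ κ s
          lemma : ∀ Y Z U ρ ρy ρz b c p d k →
            ρ * ((U - Z) * ρz * c) * (p * (ρy * d * (b * k)))
              + - (ρ * ((U - Y) * ρy * b)) * (p * (ρz * d * (c * k)))
            ≈ p * ((ρy * (ρz * d)) * (((Y - Z) * ρ * b) * (c * k)))
          lemma = solve 11 (λ Y Z U ρ ρy ρz b c p d k →
            ρ :* ((U :- Z) :* ρz :* c) :* (p :* (ρy :* d :* (b :* k))) :+ :- (ρ :* ((U :- Y) :* ρy :* b)) :* (p :* (ρz :* d :* (c :* k))) := p :* ((ρy :* (ρz :* d)) :* (((Y :- Z) :* ρ :* b) :* (c :* k)))) refl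

open import Defs
open import Data.Nat using (_∸_; _<ᵇ_; _≤_; _<_)
open import Data.Nat.ListAction using () renaming (sum to sumℕ)
import Data.Nat.ListAction.Properties as ListActionₚ
open import Data.Integer using (0ℤ; 1ℤ; -1ℤ; _-_; _*_)
open import Data.Integer using () renaming (_+_ to _+ℤ_; _<_ to _<ℤ_)
open import Data.Integer.Tactic.RingSolver using () renaming (solve-∀ to ℤ-solve)
open import Data.Bool as Bool using (true; false; if_then_else_)
open import Data.Empty using (⊥-elim)
open import Data.Unit using (tt)
open import Data.Fin as Fin using (Fin; toℕ; fromℕ<)
import Data.Fin.Properties as Finₚ
open import Data.Fin.Subset using (Subset; ∣_∣)
import Data.Fin.Subset.Properties as Subsetₚ
open import Data.List using (allFin; applyUpTo; concatMap; drop; filter; take; upTo)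
import Data.List.Properties as Listₚ
open import Data.List.Membership.Propositional using (_∈_; _∉_)
open import Data.List.Membership.Propositional.Properties
  using (∈-++⁻; ∈-++⁺ˡ; ∈-++⁺ʳ; ∈-map⁻; ∈-upTo⁺; ∈-upTo⁻; ∈-∃++)
open import Data.List.Relation.Binary.Pointwise as Pointwise using (Pointwise; []; _∷_)
import Data.List.Relation.Binary.Permutation.Propositional.Properties as Permₚ
open import Data.List.Relation.Unary.AllPairs using (AllPairs; []; _∷_)
import Data.List.Relation.Unary.AllPairs.Properties as AllPairsₚ
open import Data.List.Relation.Unary.Any using (here; there)
open import Data.List.Relation.Unary.Unique.Propositional using (Unique)
open import Data.List.Relation.Unary.Unique.Propositional.Properties using (allFin⁺; upTo⁺)
import Data.Vec
open import Data.Vec as Vec using (Vec; []; _∷_; replicate; zipWith; lookup)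
import Data.Vec.Properties as Vecₚ
open import Data.Sum using (_⊎_; inj₁; inj₂)
open import Function using (_|>_)
open import Relation.Nullary.Decidable using (⌊_⌋; dec-true; dec-false; ¬?)
open import Relation.Unary using (Pred; Decidable)
open import Relation.Binary.Definitions using (tri<; tri≈; tri>)
open import Relation.Binary.PropositionalEquality hiding (J)

open Term

-- The ring of Laurent polynomials

module _ {n : ℕ} where

  mulMono-comm : ∀ (s t : Mono n) → mulMono s t ≡ mulMono t s
  mulMono-comm (m , e) (k , f) =
    cong₂ _,_ (ℕₚ.+-comm m k) (Vecₚ.zipWith-comm ℤₚ.+-comm e f)

  mulMono-assoc : ∀ (s t u : Mono n) → mulMono (mulMono s t) u ≡ mulMono s (mulMono t u)
  mulMono-assoc (m , e) (k , f) (l , g) =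
    cong₂ _,_ (ℕₚ.+-assoc m k l) (Vecₚ.zipWith-assoc ℤₚ.+-assoc e f g)

  mulMono-identityˡ : ∀ (s : Mono n) → mulMono (qpow 0) s ≡ s
  mulMono-identityˡ (m , e) = cong (m ,_) (Vecₚ.zipWith-identityˡ ℤₚ.+-identityˡ e)

  eval : (Mono n → ℤ) → Poly n → ℤ
  eval f []                = 0ℤ
  eval f (term c m e ∷ P) = c ℤ.* f (m , e) ℤ.+ eval f P

  eval-cong : ∀ {f g} P → (∀ s → f s ≡ g s) → eval f P ≡ eval g P
  eval-cong []               f≗g = refl
  eval-cong (term c m e ∷ P) f≗g =
    cong₂ (λ a b → c ℤ.* a ℤ.+ b) (f≗g (m , e)) (eval-cong P f≗g)

  eval-++ : ∀ f P Q → eval f (P ++ Q) ≡ eval f P ℤ.+ eval f Q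
  eval-++ f []               Q = sym (ℤₚ.+-identityˡ _)
  eval-++ f (term c m e ∷ P) Q =
    trans (cong (λ z → c ℤ.* f (m , e) ℤ.+ z) (eval-++ f P Q)) (sym (ℤₚ.+-assoc (c ℤ.* f (m , e)) _ _))

  eval-neg : ∀ f P → eval f (negP P) ≡ ℤ.- eval f P
  eval-neg f []               = refl
  eval-neg f (term c m e ∷ P) =
    trans (cong (λ z → (ℤ.- c) ℤ.* f (m , e) ℤ.+ z) (eval-neg f P)) (lemma c (f (m , e)) (eval f P))
    where
    lemma : ∀ a b d → (ℤ.- a) ℤ.* b ℤ.+ ℤ.- d ≡ ℤ.- (a ℤ.* b ℤ.+ d)
    lemma = ℤ-solve

  eval-mulT : ∀ f c m e Q →
    eval f (List.map (mulT (term c m e)) Q) ≡ c ℤ.* eval (λ t → f (mulMono (m , e) t)) Q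
  eval-mulT f c m e []               = sym (ℤₚ.*-zeroʳ c)
  eval-mulT f c m e (term d k g ∷ Q) =
    trans (cong (λ z → c ℤ.* d ℤ.* f _ ℤ.+ z) (eval-mulT f c m e Q)) (lemma c d (f _) _)
    where
    lemma : ∀ a b x y → a ℤ.* b ℤ.* x ℤ.+ a ℤ.* y ≡ a ℤ.* (b ℤ.* x ℤ.+ y)
    lemma = ℤ-solve

  eval-* : ∀ f P Q → eval f (P *P Q) ≡ eval (λ s → eval (λ t → f (mulMono s t)) Q) P
  eval-* f []               Q = refl
  eval-* f (term c m e ∷ P) Q =
    trans (eval-++ f (List.map (mulT (term c m e)) Q) (P *P Q))
          (cong₂ ℤ._+_ (eval-mulT f c m e Q) (eval-* f P Q))

  eval-zero : ∀ P → eval (λ _ → 0ℤ) P ≡ 0ℤ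
  eval-zero []               = refl
  eval-zero (term c m e ∷ P) =
    trans (cong₂ ℤ._+_ (ℤₚ.*-zeroʳ c) (eval-zero P)) refl

  eval-linear : ∀ c f g P →
    eval (λ s → c ℤ.* f s ℤ.+ g s) P ≡ c ℤ.* eval f P ℤ.+ eval g P
  eval-linear c f g []               = sym (trans (ℤₚ.+-identityʳ _) (ℤₚ.*-zeroʳ c))
  eval-linear c f g (term d m e ∷ P) =
    trans (cong (λ z → d ℤ.* (c ℤ.* f (m , e) ℤ.+ g (m , e)) ℤ.+ z) (eval-linear c f g P))
          (lemma c d (f (m , e)) (g (m , e)) (eval f P) (eval g P))
    where
    lemma : ∀ c d x y X Y →
      d ℤ.* (c ℤ.* x ℤ.+ y) ℤ.+ (c ℤ.* X ℤ.+ Y) ≡ c ℤ.* (d ℤ.* x ℤ.+ X) ℤ.+ (d ℤ.* y ℤ.+ Y)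
    lemma = ℤ-solve

  eval-swap : ∀ (f : Mono n → Mono n → ℤ) P Q →
    eval (λ s → eval (f s) Q) P ≡ eval (λ t → eval (λ s → f s t) P) Q
  eval-swap f []               Q = sym (eval-zero Q)
  eval-swap f (term c m e ∷ P) Q =
    trans (cong (λ z → c ℤ.* eval (f (m , e)) Q ℤ.+ z) (eval-swap f P Q))
          (sym (eval-linear c (f (m , e)) _ Q))

  -- Two polynomials are identified when every linear functional on the span of
  -- the monomials takes the same value on them.
  infix 4 _≈_
  record _≈_ (P Q : Poly n) : Set where
    constructor mk≈
    field eval-≡ : ∀ f → eval f P ≡ eval f Q
  open _≈_ public

  ≈-refl : ∀ {P} → P ≈ P
  ≈-refl = mk≈ λ _ → refl

  ≈-reflexive : ∀ {P Q} → P ≡ Q → P ≈ Q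
  ≈-reflexive refl = ≈-refl

  +P-cong : ∀ {P P′ Q Q′} → P ≈ P′ → Q ≈ Q′ → P +P Q ≈ P′ +P Q′
  +P-cong {P} {P′} {Q} {Q′} p q = mk≈ λ f →
    trans (eval-++ f P Q) (trans (cong₂ ℤ._+_ (eval-≡ p f) (eval-≡ q f)) (sym (eval-++ f P′ Q′)))

  *P-cong : ∀ {P P′ Q Q′} → P ≈ P′ → Q ≈ Q′ → P *P Q ≈ P′ *P Q′
  *P-cong {P} {P′} {Q} {Q′} p q = mk≈ λ f →
    trans (eval-* f P Q) (trans (eval-≡ p _)
      (trans (eval-cong P′ (λ s → eval-≡ q _)) (sym (eval-* f P′ Q′))))

  *P-comm : ∀ P Q → P *P Q ≈ Q *P P
  *P-comm P Q = mk≈ λ f →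
    trans (eval-* f P Q) (trans (eval-swap (λ s t → f (mulMono s t)) P Q)
      (trans (eval-cong Q (λ t → eval-cong P (λ s → cong f (mulMono-comm s t))))
        (sym (eval-* f Q P))))

  *P-assoc : ∀ P Q R → (P *P Q) *P R ≈ P *P (Q *P R)
  *P-assoc P Q R = mk≈ λ f →
    trans (eval-* f (P *P Q) R) (trans (eval-* _ P Q)
      (trans (eval-cong P (λ s →
         trans (eval-cong Q (λ t → eval-cong R (λ u → cong f (mulMono-assoc s t u))))
               (sym (eval-* (λ z → f (mulMono s z)) Q R))))
        (sym (eval-* f P (Q *P R)))))

  *P-identityˡ : ∀ P → oneP *P P ≈ P
  *P-identityˡ P = mk≈ λ f →
    trans (eval-* f oneP P) (trans (ℤₚ.+-identityʳ _) (trans (ℤₚ.*-identityˡ _)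
      (eval-cong P (λ s → cong f (mulMono-identityˡ s)))))

  *P-distribʳ : ∀ R P Q → (P +P Q) *P R ≈ (P *P R) +P (Q *P R)
  *P-distribʳ R P Q = mk≈ λ f →
    trans (eval-* f (P +P Q) R) (trans (eval-++ _ P Q)
      (trans (sym (cong₂ ℤ._+_ (eval-* f P R) (eval-* f Q R))) (sym (eval-++ f (P *P R) (Q *P R)))))

  ≈-trans : ∀ {P Q R} → P ≈ Q → Q ≈ R → P ≈ R
  ≈-trans p q = mk≈ λ f → trans (eval-≡ p f) (eval-≡ q f)

  ≈-sym : ∀ {P Q} → P ≈ Q → Q ≈ P
  ≈-sym p = mk≈ λ f → sym (eval-≡ p f)

  +P-comm : ∀ P Q → P +P Q ≈ Q +P P
  +P-comm P Q = mk≈ λ f →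
    trans (eval-++ f P Q) (trans (ℤₚ.+-comm (eval f P) _) (sym (eval-++ f Q P)))

  +P-assoc : ∀ P Q R → (P +P Q) +P R ≈ P +P (Q +P R)
  +P-assoc P Q R = mk≈ λ f →
    trans (eval-++ f (P +P Q) R) (trans (cong (λ z → z ℤ.+ eval f R) (eval-++ f P Q))
      (trans (ℤₚ.+-assoc (eval f P) _ _)
        (sym (trans (eval-++ f P (Q +P R)) (cong (λ z → eval f P ℤ.+ z) (eval-++ f Q R))))))

  +P-inverseʳ : ∀ P → P +P negP P ≈ zeroP
  +P-inverseʳ P = mk≈ λ f →
    trans (eval-++ f P (negP P)) (trans (cong (λ z → eval f P ℤ.+ z) (eval-neg f P)) (ℤₚ.+-inverseʳ (eval f P)))

  negP-cong : ∀ {P Q} → P ≈ Q → negP P ≈ negP Q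
  negP-cong {P} {Q} p = mk≈ λ f →
    trans (eval-neg f P) (trans (cong ℤ.-_ (eval-≡ p f)) (sym (eval-neg f Q)))

polyRing : ℕ → CommutativeRing _ _
polyRing n = record
  { Carrier = Poly n
  ; _≈_ = _≈_
  ; _+_ = _+P_
  ; _*_ = _*P_
  ; -_ = negP
  ; 0# = zeroP
  ; 1# = oneP
  ; isCommutativeRing = record
    { isRing = record
      { +-isAbelianGroup = record
        { isGroup = record
          { isMonoid = record
            { isSemigroup = record
              { isMagma = record
                { isEquivalence = record { refl = ≈-refl ; sym = ≈-sym ; trans = ≈-trans }
                ; ∙-cong = +P-cong
                }
              ; assoc = +P-assoc
              }
            ; identity = (λ P → ≈-refl) , λ P → ≈-trans (+P-comm P zeroP) ≈-refl
            }
          ; inverse = (λ P → ≈-trans (+P-comm (negP P) P) (+P-inverseʳ P)) , +P-inverseʳ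
          ; ⁻¹-cong = negP-cong
          }
        ; comm = +P-comm
        }
      ; *-cong = *P-cong
      ; *-assoc = *P-assoc
      ; *-identity = *P-identityˡ , λ P → ≈-trans (*P-comm P oneP) (*P-identityˡ P)
      ; distrib = (λ P Q R → ≈-trans (*P-comm P (Q +P R)) (≈-trans (*P-distribʳ P Q R)
                    (+P-cong (*P-comm Q P) (*P-comm R P)))) , *P-distribʳ
      }
    ; *-comm = *P-comm
    }
  }

δ : ∀ {n} → Mono n → Mono n → ℤ
δ (m , v) (k , e) with m ℕ.≟ k | Vecₚ.≡-dec ℤ._≟_ v e
... | yes _ | yes _ = 1ℤ
... | _     | _     = 0ℤ

coeff-eval : ∀ {n} m v (P : Poly n) → coeff m v P ≡ eval (δ (m , v)) P
coeff-eval m v []               = refl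
coeff-eval m v (term c k e ∷ P) with m ℕ.≟ k | Vecₚ.≡-dec ℤ._≟_ v e
... | yes _ | yes _ = cong₂ ℤ._+_ (sym (ℤₚ.*-identityʳ c)) (coeff-eval m v P)
... | yes _ | no _  = trans (coeff-eval m v P) (sym (trans (cong (λ z → z ℤ.+ _) (ℤₚ.*-zeroʳ c)) (ℤₚ.+-identityˡ _)))
... | no _  | yes _ = trans (coeff-eval m v P) (sym (trans (cong (λ z → z ℤ.+ _) (ℤₚ.*-zeroʳ c)) (ℤₚ.+-identityˡ _)))
... | no _  | no _  = trans (coeff-eval m v P) (sym (trans (cong (λ z → z ℤ.+ _) (ℤₚ.*-zeroʳ c)) (ℤₚ.+-identityˡ _)))

-- Supports of Laurent polynomials

module _ {n : ℕ} where

  open CommutativeRing (polyRing n) using (*-assoc; *-identityˡ; zeroʳ; distribˡ)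

  h-unfold : ∀ r (y : Mono n) Y →
    h r (y ∷ Y) ≡ sumP (List.map (λ s → powP (monoP y) s *P h (r ∸ s) Y) (upTo (suc r)))
  h-unfold zero    y Y = refl
  h-unfold (suc r) y Y = refl

  sumP-shift : ∀ (P : Poly n) (F G : ℕ → Poly n) → (∀ s → F (suc s) ≈ P *P G s) → ∀ g k →
    sumP (List.map F (applyUpTo (λ s → suc (g s)) k)) ≈ P *P sumP (List.map G (applyUpTo g k))
  sumP-shift P F G eq g zero    = ≈-sym (zeroʳ P)
  sumP-shift P F G eq g (suc k) = ≈-trans
    (+P-cong (eq (g 0)) (sumP-shift P F G eq (λ s → g (suc s)) k))
    (≈-sym (distribˡ P (G (g 0)) _))

  h-zero : ∀ (Y : List (Mono n)) → h 0 Y ≈ oneP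
  h-zero []      = ≈-refl
  h-zero (y ∷ Y) = ≈-trans (+P-comm (oneP *P h 0 Y) []) (≈-trans (*P-identityˡ (h 0 Y)) (h-zero Y))

  h-nil : ∀ r → h (suc r) [] ≈ zeroP {n}
  h-nil r = ≈-refl

  h-suc : ∀ r (y : Mono n) Y → h (suc r) (y ∷ Y) ≈ h (suc r) Y +P (monoP y *P h r (y ∷ Y))
  h-suc r y Y = +P-cong (*P-identityˡ (h (suc r) Y))
    (≈-trans
      (sumP-shift (monoP y) _ (λ s → powP (monoP y) s *P h (r ∸ s) Y)
        (λ s → *-assoc (monoP y) (powP (monoP y) s) (h (r ∸ s) Y)) (λ s → s) (suc r))
      (≈-reflexive (cong (monoP y *P_) (sym (h-unfold r y Y)))))

  -- Says that every exponent with a nonzero coefficient satisfies `Q`, in a form insensitive to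
  -- cancelling terms. Only functionals vanishing from some q-degree `B` on are tested: this is what
  -- makes multiplication by q^k - q^l cancellable, and coefficient extraction is of this kind.
  record Supported (Q : Vec ℤ n → Set) (P : Poly n) : Set where
    constructor supported
    field
      vanish : ∀ f B → (∀ {k e} → B ℕ.≤ k → f (k , e) ≡ 0ℤ) → (∀ {k e} → Q e → f (k , e) ≡ 0ℤ) →
               eval f P ≡ 0ℤ
  open Supported public

  module _ {Q : Vec ℤ n → Set} where

    supported-≈ : ∀ {P P′} → P ≈ P′ → Supported Q P → Supported Q P′
    supported-≈ eq s .vanish f B b q = trans (sym (eval-≡ eq f)) (vanish s f B b q)

    supported-+ : ∀ {P P′} → Supported Q P → Supported Q P′ → Supported Q (P +P P′)
    supported-+ {P} {P′} s s′ .vanish f B b q =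
      trans (eval-++ f P P′) (cong₂ ℤ._+_ (vanish s f B b q) (vanish s′ f B b q))

    supported-neg : ∀ {P} → Supported Q P → Supported Q (negP P)
    supported-neg {P} s .vanish f B b q =
      trans (eval-neg f P) (cong ℤ.-_ (vanish s f B b q))

    supported-zero : Supported Q zeroP
    supported-zero .vanish f B b q = refl

    supported-sum : ∀ {a} {A : Set a} (F : A → Poly n) {xs} →
      All (λ x → Supported Q (F x)) xs → Supported Q (sumP (List.map F xs))
    supported-sum F []       = supported-zero
    supported-sum F (p ∷ ps) = supported-+ p (supported-sum F ps)

    eval-∈ : ∀ f (P : Poly n) → (∀ {t} → t ∈ P → f (qexp t , xexp t) ≡ 0ℤ) → eval f P ≡ 0ℤ
    eval-∈ f []               z = refl
    eval-∈ f (term c m e ∷ P) z =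
      cong₂ ℤ._+_ (trans (cong (c ℤ.*_) (z (here refl))) (ℤₚ.*-zeroʳ c)) (eval-∈ f P (λ t∈ → z (there t∈)))

    supported-all : ∀ {P} → (∀ {t} → t ∈ P → Q (xexp t)) → Supported Q P
    supported-all {P} all .vanish f B b q = eval-∈ f P (λ t∈ → q (all t∈))

    -- The two factors are treated differently: the terms of `P` are inspected one by one, and for
    -- each of them the functional shifted by that term is tested on `R`.
    supported-* : ∀ {Q′ : Vec ℤ n → Set} {P R} →
      (∀ {t} → t ∈ P → ∀ {u} → Q′ u → Q (zipWith ℤ._+_ (xexp t) u)) →
      Supported Q′ R → Supported Q (P *P R)
    supported-* {Q′} {P} {R} all s .vanish f B b q = trans (eval-* f P R)
      (eval-∈ _ P (λ {t} t∈ → vanish s (λ u → f (mulMono (qexp t , xexp t) u)) B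
        (λ B≤k → b (ℕₚ.≤-trans B≤k (ℕₚ.m≤n+m _ (qexp t)))) (λ Q′u → q (all t∈ Q′u))))

    -- f (q^(m∸k) x^e q^(t(d+1))) pairs with (q^k − q^(k+d+1)) P to the difference of the
    -- values of f on the shifts of P by t and t + 1 periods; the shifts eventually vanish.
    torsion< : ∀ k d {P} →
      Supported Q ((monoP (qpow k) +P negP (monoP (qpow (k ℕ.+ suc d)))) *P P) → Supported Q P
    torsion< k d {P} s .vanish f B b q = trans (sym (eval-cong P (λ _ → cong f (cong (_, _) (ℕₚ.+-identityʳ _)))))
      (trans (shifts B) (trans (eval-cong P (λ (m , e) → b (bound m))) (eval-zero P)))
      where
      shifted : ℕ → Mono n → ℤ
      shifted t (m , e) = f (m ℕ.+ t ℕ.* suc d , e)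
      bound : ∀ m → B ℕ.≤ m ℕ.+ B ℕ.* suc d
      bound m = ℕₚ.≤-trans (ℕₚ.m≤m*n B (suc d)) (ℕₚ.m≤n+m _ m)
      step : ∀ t → eval (shifted t) P ≡ eval (shifted (suc t)) P
      step t = ℤₚ.i-j≡0⇒i≡j _ _ (trans (sym (trans (eval-* g (monoP (qpow k) +P negP (monoP (qpow (k ℕ.+ suc d)))) P)
        (trans (cong₂ (λ x y → 1ℤ ℤ.* x ℤ.+ ((ℤ.- 1ℤ) ℤ.* y ℤ.+ 0ℤ))
          (eval-cong P (λ (m , e) → cong f (cong₂ _,_ (cong (ℕ._+ t ℕ.* suc d) (ℕₚ.m+n∸m≡n k m))
             (Vecₚ.zipWith-identityˡ ℤₚ.+-identityˡ e))))
          (eval-cong P (λ (m , e) → cong f (cong₂ _,_ (arith m)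
             (Vecₚ.zipWith-identityˡ ℤₚ.+-identityˡ e)))))
          (lemma (eval (shifted t) P) (eval (shifted (suc t)) P)))))
        (vanish s g (B ℕ.+ k) (λ {m} B+k≤m → b (ℕₚ.≤-trans
           (ℕₚ.≤-trans (ℕₚ.≤-reflexive (sym (ℕₚ.m+n∸n≡m B k))) (ℕₚ.∸-monoˡ-≤ k B+k≤m))
           (ℕₚ.m≤m+n (m ∸ k) _))) q))
        where
        g : Mono n → ℤ
        g (m , e) = f ((m ∸ k) ℕ.+ t ℕ.* suc d , e)
        arith : ∀ m → (k ℕ.+ suc d ℕ.+ m ∸ k) ℕ.+ t ℕ.* suc d ≡ m ℕ.+ suc t ℕ.* suc d
        arith m = trans (cong (λ z → z ∸ k ℕ.+ t ℕ.* suc d) (ℕₚ.+-assoc k (suc d) m))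
          (trans (cong (ℕ._+ t ℕ.* suc d) (trans (ℕₚ.m+n∸m≡n k (suc d ℕ.+ m)) (ℕₚ.+-comm (suc d) m)))
            (ℕₚ.+-assoc m (suc d) (t ℕ.* suc d)))
        lemma : ∀ x y → 1ℤ ℤ.* x ℤ.+ ((ℤ.- 1ℤ) ℤ.* y ℤ.+ 0ℤ) ≡ x ℤ.- y
        lemma x y = cong₂ ℤ._+_ (ℤₚ.*-identityˡ x) (trans (ℤₚ.+-identityʳ _) (ℤₚ.-1*i≡-i y))
      shifts : ∀ t → eval (shifted 0) P ≡ eval (shifted t) P
      shifts zero    = refl
      shifts (suc t) = trans (shifts t) (step t)

    torsion : ∀ {k l P} → k ≢ l →
      Supported Q ((monoP (qpow k) +P negP (monoP (qpow l))) *P P) → Supported Q P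
    torsion {k} {l} {P} k≢l s with ℕₚ.<-cmp k l
    ... | tri≈ _ k≡l _ = contradiction k≡l k≢l
    ... | tri< k<l _ _ with ℕₚ.m≤n⇒∃[o]m+o≡n k<l
    ...   | d , refl = torsion< k d
            (subst (λ z → Supported Q ((monoP (qpow k) +P negP (monoP (qpow z))) *P P)) (sym (ℕₚ.+-suc k d)) s)
    torsion {k} {l} {P} k≢l s | tri> _ _ l<k with ℕₚ.m≤n⇒∃[o]m+o≡n l<k
    ...   | d , refl = torsion< l d (supported-≈ (lemma (monoP (qpow (suc l ℕ.+ d))) (monoP (qpow l)) P)
            (supported-neg s) |> subst (λ z → Supported Q ((monoP (qpow l) +P negP (monoP (qpow z))) *P P)) (sym (ℕₚ.+-suc l d)))
      where
      lemma : ∀ x y P → negP ((x +P negP y) *P P) ≈ (y +P negP x) *P P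
      lemma x y P = RingLemmas.neg-diff-* (polyRing n) x y P

    -- Multiplication by q^k is undone by precomposing the functional with m ↦ m ∸ k.
    q-cancel : ∀ k {P} → Supported Q (monoP (qpow k) *P P) → Supported Q P
    q-cancel k {P} s .vanish f B b q = trans (sym (trans (eval-* g (monoP (qpow k)) P)
      (trans (ℤₚ.+-identityʳ _) (trans (ℤₚ.*-identityˡ _) (eval-cong P (λ (m , e) →
        cong f (cong₂ _,_ (ℕₚ.m+n∸m≡n k m) (Vecₚ.zipWith-identityˡ ℤₚ.+-identityˡ e))))))))
      (vanish s g (B ℕ.+ k) (λ {m} B+k≤m → b
           (ℕₚ.≤-trans (ℕₚ.≤-reflexive (sym (ℕₚ.m+n∸n≡m B k))) (ℕₚ.∸-monoˡ-≤ k B+k≤m))) q)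
      where
      g : Mono n → ℤ
      g (m , e) = f (m ∸ k , e)

  record Additive (ℓ : Vec ℤ n → ℤ) : Set where
    field
      ℓ-zero : ℓ (replicate n 0ℤ) ≡ 0ℤ
      ℓ-+    : ∀ e f → ℓ (zipWith ℤ._+_ e f) ≡ ℓ e ℤ.+ ℓ f
  open Additive public

  infix 4 _⊢_≤_
  -- A bound on each term of the list as it stands, not up to cancellation. It does not pass along
  -- `_≈_`, so it is derived from the way in which a product is built.
  record _⊢_≤_ (ℓ : Vec ℤ n → ℤ) (P : Poly n) (c : ℤ) : Set where
    constructor bounded
    field bound : All (λ t → ℓ (xexp t) ℤ.≤ c) P
  open _⊢_≤_ public

  module _ {ℓ : Vec ℤ n → ℤ} where

    bound-weaken : ∀ {P c d} → c ℤ.≤ d → ℓ ⊢ P ≤ c → ℓ ⊢ P ≤ d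
    bound-weaken c≤d p .bound = All.map (λ q → ℤₚ.≤-trans q c≤d) (bound p)

    bound-+ : ∀ {P Q c} → ℓ ⊢ P ≤ c → ℓ ⊢ Q ≤ c → ℓ ⊢ P +P Q ≤ c
    bound-+ p q .bound = Allₚ.++⁺ (bound p) (bound q)

    bound-neg : ∀ {P c} → ℓ ⊢ P ≤ c → ℓ ⊢ negP P ≤ c
    bound-neg p .bound = Allₚ.map⁺ (All.map (λ z → z) (bound p))

    bound-monoP : ∀ {m e c} → ℓ e ℤ.≤ c → ℓ ⊢ monoP (m , e) ≤ c
    bound-monoP p .bound = p ∷ []

  module _ {ℓ : Vec ℤ n → ℤ} (add : Additive ℓ) where

    bound-oneP : ℓ ⊢ oneP ≤ 0ℤ
    bound-oneP = bound-monoP {m = 0} (ℤₚ.≤-reflexive (ℓ-zero add))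

    bound-qpow : ∀ k → ℓ ⊢ monoP (qpow k) ≤ 0ℤ
    bound-qpow k = bound-monoP {m = k} (ℤₚ.≤-reflexive (ℓ-zero add))

    bound-* : ∀ {P Q c d} → ℓ ⊢ P ≤ c → ℓ ⊢ Q ≤ d → ℓ ⊢ P *P Q ≤ c ℤ.+ d
    bound-* {P} {Q} (bounded p) (bounded q) .bound = Allₚ.concat⁺ (Allₚ.map⁺ (All.map
      (λ {s} s≤c → Allₚ.map⁺ (All.map (λ {t} t≤d →
        ℤₚ.≤-trans (ℤₚ.≤-reflexive (ℓ-+ add (xexp s) (xexp t))) (ℤₚ.+-mono-≤ s≤c t≤d)) q)) p))

    bound-∏ : ∀ {a} {A : Set a} (F : A → Poly n) d → (∀ x → ℓ ⊢ F x ≤ + d) → ∀ xs →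
      ℓ ⊢ prodP (List.map F xs) ≤ + (length xs ℕ.* d)
    bound-∏ F d p []       = bound-oneP
    bound-∏ F d p (x ∷ xs) = bound-* (p x) (bound-∏ F d p xs)

    bound-∏≤0 : ∀ {a} {A : Set a} (F : A → Poly n) {xs} → (∀ {x} → x ∈ xs → ℓ ⊢ F x ≤ 0ℤ) →
      ℓ ⊢ prodP (List.map F xs) ≤ 0ℤ
    bound-∏≤0 F {[]}     p = bound-oneP
    bound-∏≤0 F {x ∷ xs} p = bound-* (p (here refl)) (bound-∏≤0 F (λ z → p (there z)))

    bound-∏∈ : ∀ {a} {A : Set a} (F : A → Poly n) {x c xs} → (∀ {x} → x ∈ xs → ℓ ⊢ F x ≤ 0ℤ) →
      x ∈ xs → ℓ ⊢ F x ≤ c → ℓ ⊢ prodP (List.map F xs) ≤ c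
    bound-∏∈ F p (here refl) q = bound-weaken (ℤₚ.≤-reflexive (ℤₚ.+-identityʳ _))
      (bound-* q (bound-∏≤0 F (λ z → p (there z))))
    bound-∏∈ F p (there x∈) q = bound-weaken (ℤₚ.≤-reflexive (ℤₚ.+-identityˡ _))
      (bound-* (p (here refl)) (bound-∏∈ F (λ z → p (there z)) x∈ q))

  factor : Mono n → ℕ → Poly n
  factor z t = oneP +P negP (monoP (mulMono z (qpow t)))

  bound-factor : ∀ {ℓ} → Additive ℓ → ∀ {z d} → ℓ (proj₂ z) ℤ.≤ + d → ∀ t → ℓ ⊢ factor z t ≤ + d
  bound-factor {ℓ} add {z} z≤d t = bound-+
    (bound-weaken (ℤ.+≤+ ℕ.z≤n) (bound-oneP add))
    (bound-neg (bound-monoP (ℤₚ.≤-trans (ℤₚ.≤-reflexive (trans (ℓ-+ add (proj₂ z) _)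
      (trans (cong (λ w → ℓ (proj₂ z) ℤ.+ w) (ℓ-zero add)) (ℤₚ.+-identityʳ _)))) z≤d)))

  bound-qPoch : ∀ {ℓ} → Additive ℓ → ∀ {z d} → ℓ (proj₂ z) ℤ.≤ + d → ∀ b →
    ℓ ⊢ qPoch z b ≤ + (b ℕ.* d)
  bound-qPoch {ℓ} add {z} {d} z≤d b = subst (λ k → ℓ ⊢ qPoch z b ≤ + (k ℕ.* d)) (Listₚ.length-upTo b)
    (bound-∏ add (factor z) d (bound-factor add z≤d) (upTo b))

  -- The bound is delivered together with the quotient because it depends on the list chosen for
  -- `R`, the product of the other b - 1 factors.
  qPoch-factor : ∀ z {b t} → t ℕ.< b →
    ∃[ R ] (qPoch z b ≈ factor z t *P R) ×
           (∀ {ℓ} → Additive ℓ → ∀ {d} → ℓ (proj₂ z) ℤ.≤ + d → ℓ ⊢ R ≤ + ((b ∸ 1) ℕ.* d))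
  qPoch-factor z {b} {t} t<b with ∈-∃++ (∈-upTo⁺ t<b)
  ... | xs , ys , eq = prodP (List.map (factor z) (xs ++ ys)) ,
      ∏-↭ (factor z) perm ,
      λ {ℓ} add {d} z≤d → subst (λ k → ℓ ⊢ prodP (List.map (factor z) (xs ++ ys)) ≤ + (k ℕ.* d)) len
        (bound-∏ add (factor z) d (bound-factor add z≤d) (xs ++ ys))
    where
    open RingLemmas (polyRing n)
    perm : upTo b ↭ t ∷ xs ++ ys
    perm = subst (_↭ t ∷ xs ++ ys) (sym eq) (Permₚ.shift t xs ys)
    len : length (xs ++ ys) ≡ b ∸ 1
    len = cong (_∸ 1) (trans (sym (Permₚ.↭-length perm)) (Listₚ.length-upTo b))

-- The kernel

module _ {n : ℕ} where

  vec-ext : ∀ {xs ys : Vec ℤ n} → (∀ m → lookup xs m ≡ lookup ys m) → xs ≡ ys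
  vec-ext {xs} {ys} eq = trans (sym (Vecₚ.tabulate∘lookup xs))
    (trans (Vecₚ.tabulate-cong eq) (Vecₚ.tabulate∘lookup ys))

  lookup-additive : ∀ (m : Fin n) → Additive (λ e → lookup e m)
  lookup-additive m = record
    { ℓ-zero = Vecₚ.lookup-replicate m 0ℤ
    ; ℓ-+    = λ e f → Vecₚ.lookup-zipWith ℤ._+_ m e f
    }

  unitV-≡ : ∀ (i : Fin n) → lookup (unitV i) i ≡ 1ℤ
  unitV-≡ i = Vecₚ.lookup∘updateAt i (replicate n 0ℤ)

  unitV-≢ : ∀ {i m : Fin n} → m ≢ i → lookup (unitV i) m ≡ 0ℤ
  unitV-≢ {i} {m} m≢i = trans (Vecₚ.lookup∘updateAt′ m i m≢i (replicate n 0ℤ)) (Vecₚ.lookup-replicate m 0ℤ)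

  ratio-lookup : ∀ (i j m : Fin n) →
    lookup (proj₂ (ratio i j)) m ≡ lookup (unitV i) m ℤ.- lookup (unitV j) m
  ratio-lookup i j m = Vecₚ.lookup-zipWith ℤ._-_ m (unitV i) (unitV j)

  letter : Fin n → ℕ → Mono n
  letter i k = mulMono (xM i) (qpow k)

  negUnitV : Fin n → Vec ℤ n
  negUnitV i = Vec.map ℤ.-_ (unitV i)

  negUnitV-lookup : ∀ (i m : Fin n) → lookup (negUnitV i) m ≡ ℤ.- lookup (unitV i) m
  negUnitV-lookup i m = Vecₚ.lookup-map m ℤ.-_ (unitV i)

  letter-lookup : ∀ (i : Fin n) k (w : Vec ℤ n) m →
    lookup (zipWith ℤ._+_ (proj₂ (letter i k)) w) m ≡ lookup (unitV i) m ℤ.+ lookup w m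
  letter-lookup i k w m = trans (Vecₚ.lookup-zipWith ℤ._+_ m (proj₂ (letter i k)) w)
    (cong (λ z → z ℤ.+ lookup w m) (trans (Vecₚ.lookup-zipWith ℤ._+_ m (unitV i) (replicate n 0ℤ))
      (trans (cong (λ z → lookup (unitV i) m ℤ.+ z) (Vecₚ.lookup-replicate m 0ℤ)) (ℤₚ.+-identityʳ (lookup (unitV i) m)))))

  0+ : ∀ (w : Vec ℤ n) → zipWith ℤ._+_ (replicate n 0ℤ) w ≡ w
  0+ = Vecₚ.zipWith-identityˡ ℤₚ.+-identityˡ

  +0 : ∀ (w : Vec ℤ n) → zipWith ℤ._+_ w (replicate n 0ℤ) ≡ w
  +0 = Vecₚ.zipWith-identityʳ ℤₚ.+-identityʳ

  -- The inverse of a letter would need a negative power of q, which terms cannot have. Multiplying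
  -- by q^B with k ≤ B first makes the cofactor of the letter a monomial.
  letter-cancel : ∀ (i : Fin n) {k B} → k ℕ.≤ B →
    mulMono (qpow B) (qpow 0) ≡ mulMono (letter i k) (B ∸ k , negUnitV i)
  letter-cancel i {k} {B} k≤B = cong₂ _,_ (trans (ℕₚ.+-identityʳ B) (sym (ℕₚ.m+[n∸m]≡n k≤B)))
    (trans (0+ _) (vec-ext λ m → trans (Vecₚ.lookup-replicate m 0ℤ) (sym (trans
      (letter-lookup i k (negUnitV i) m) (trans (cong (λ z → lookup (unitV i) m ℤ.+ z) (negUnitV-lookup i m))
        (ℤₚ.+-inverseʳ (lookup (unitV i) m)))))))

  letter-ratio : ∀ (i j : Fin n) k →
    proj₂ (ratio i j) ≡ zipWith ℤ._+_ (proj₂ (letter i k)) (negUnitV j)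
  letter-ratio i j k = vec-ext λ m → trans (ratio-lookup i j m) (sym (trans
    (letter-lookup i k (negUnitV j) m) (cong (λ z → lookup (unitV i) m ℤ.+ z) (negUnitV-lookup j m))))

  ratio-letters : ∀ (i j : Fin n) t {l B} → l ℕ.≤ B →
    mulMono (qpow B) (mulMono (ratio i j) (qpow t)) ≡ mulMono (letter i (l ℕ.+ t)) (B ∸ l , negUnitV j)
  ratio-letters i j t {l} {B} l≤B = cong₂ _,_
    (trans (cong (ℕ._+ t) (sym (ℕₚ.m∸n+n≡m l≤B))) (trans (ℕₚ.+-assoc (B ∸ l) l t) (ℕₚ.+-comm (B ∸ l) (l ℕ.+ t))))
    (trans (0+ _) (trans (+0 _) (letter-ratio i j (l ℕ.+ t))))

  q-ratio-letters : ∀ (i j : Fin n) t {l B} → l ℕ.≤ B →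
    mulMono (qpow B) (mulMono (mulMono (qpow 1) (ratio i j)) (qpow t))
      ≡ mulMono (letter i (suc l ℕ.+ t)) (B ∸ l , negUnitV j)
  q-ratio-letters i j t {l} {B} l≤B = cong₂ _,_
    (trans (cong (ℕ._+ suc t) (sym (ℕₚ.m∸n+n≡m l≤B))) (trans (ℕₚ.+-assoc (B ∸ l) l (suc t))
      (trans (ℕₚ.+-comm (B ∸ l) (l ℕ.+ suc t)) (cong (ℕ._+ (B ∸ l)) (ℕₚ.+-suc l t)))))
    (trans (0+ _) (trans (+0 _) (trans (0+ _) (letter-ratio i j (suc l ℕ.+ t)))))

module Kernel {n : ℕ} (n₀ : ℕ) (a : Vec ℕ n) (a-pos : ∀ i → 1 ℕ.≤ lookup a i) where

  open RingLemmas (polyRing n)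

  -- p_I (n − n₀ − j + p_I) is the sum of ε i k over i ∈ I and k ∉ I.
  ε : Fin n → Fin n → ℤ
  ε i j = + χ n₀ i ℤ.* (1ℤ ℤ.- + χ n₀ j)

  b : Fin n → ℕ
  b i = lookup a i ∸ χ n₀ i

  χ≤1 : ∀ i → χ n₀ {n} i ℕ.≤ 1
  χ≤1 i with toℕ i <ᵇ n₀
  ... | true  = ℕₚ.≤-refl
  ... | false = ℕ.z≤n

  χ-antitone : ∀ {i j : Fin n} → toℕ i ℕ.< toℕ j → χ n₀ j ℕ.≤ χ n₀ i
  χ-antitone {i} {j} i<j with toℕ j <ᵇ n₀ in eqⱼ | toℕ i <ᵇ n₀ in eqᵢ
  ... | false | _     = ℕ.z≤n
  ... | true  | true  = ℕₚ.≤-refl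
  ... | true  | false = ⊥-elim (subst Bool.T eqᵢ (ℕₚ.<⇒<ᵇ (ℕₚ.<-trans i<j (ℕₚ.<ᵇ⇒< (toℕ j) n₀ (subst Bool.T (sym eqⱼ) tt)))))

  ε-nonneg : ∀ i j → 0ℤ ℤ.≤ ε i j
  ε-nonneg i j = lemma (χ≤1 i) (χ≤1 j)
    where
    lemma : ∀ {x y} → x ℕ.≤ 1 → y ℕ.≤ 1 → 0ℤ ℤ.≤ + x ℤ.* (1ℤ ℤ.- + y)
    lemma ℕ.z≤n             _                 = ℤₚ.≤-refl
    lemma (ℕ.s≤s ℕ.z≤n) ℕ.z≤n             = ℤ.+≤+ ℕ.z≤n
    lemma (ℕ.s≤s ℕ.z≤n) (ℕ.s≤s ℕ.z≤n) = ℤₚ.≤-refl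

  ε-zero : ∀ {i j} → χ n₀ i ℕ.≤ χ n₀ j → ε i j ≡ 0ℤ
  ε-zero {i} {j} i≤j = lemma (χ≤1 j) i≤j
    where
    lemma : ∀ {x y} → y ℕ.≤ 1 → x ℕ.≤ y → + x ℤ.* (1ℤ ℤ.- + y) ≡ 0ℤ
    lemma _               ℕ.z≤n           = refl
    lemma (ℕ.s≤s ℕ.z≤n) (ℕ.s≤s ℕ.z≤n) = refl

  -- The length of the second q-factorial of a pair i < j, with χ taken at the first index. It
  -- equals `b j` except for i ≤ n₀ < j, where it is smaller by one; this defect is `ε i j`.
  β : Fin n → Fin n → ℕ
  β i j = lookup a j ∸ χ n₀ i

  β≤b : ∀ {i j} → toℕ i ℕ.< toℕ j → β i j ℕ.≤ b j
  β≤b {i} {j} i<j = ℕₚ.∸-monoʳ-≤ (lookup a j) (χ-antitone i<j)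

  b≤1+β : ∀ i j → b j ℕ.≤ suc (β i j)
  b≤1+β i j = lemma (lookup a j) (χ n₀ j) (χ≤1 i)
    where
    lemma : ∀ z y {x} → x ℕ.≤ 1 → z ∸ y ℕ.≤ suc (z ∸ x)
    lemma z       y ℕ.z≤n           = ℕₚ.≤-trans (ℕₚ.m∸n≤m z y) (ℕₚ.n≤1+n z)
    lemma zero    y (ℕ.s≤s ℕ.z≤n) = ℕₚ.≤-trans (ℕₚ.m∸n≤m 0 y) ℕ.z≤n
    lemma (suc z) y (ℕ.s≤s ℕ.z≤n) = ℕₚ.m∸n≤m (suc z) y

  β-ε : ∀ {i j} → toℕ i ℕ.< toℕ j → + β i j ℤ.- 1ℤ ℤ.≤ (+ b j ℤ.- 1ℤ) ℤ.- ε i j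
  β-ε {i} {j} i<j = lemma (χ≤1 i) (χ-antitone i<j) (a-pos j)
    where
    lemma : ∀ {x y z} → x ℕ.≤ 1 → y ℕ.≤ x → 1 ℕ.≤ z →
      + (z ∸ x) ℤ.- 1ℤ ℤ.≤ (+ (z ∸ y) ℤ.- 1ℤ) ℤ.- + x ℤ.* (1ℤ ℤ.- + y)
    lemma ℕ.z≤n           ℕ.z≤n           _               = ℤₚ.≤-reflexive (sym (ℤₚ.+-identityʳ _))
    lemma (ℕ.s≤s ℕ.z≤n) ℕ.z≤n           (ℕ.s≤s {n = z} _) = ℤₚ.≤-reflexive refl
    lemma (ℕ.s≤s ℕ.z≤n) (ℕ.s≤s ℕ.z≤n) _               = ℤₚ.≤-reflexive (sym (ℤₚ.+-identityʳ _))

  pairKernel : Fin n → Fin n → Poly n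
  pairKernel i j = qPoch (ratio i j) (b i) *P qPoch (mulMono (qpow 1) (ratio j i)) (β i j)

  val : Fin n → ℕ → Poly n
  val i k = monoP (letter i k)

  B : Fin n → Fin n → ℕ
  B i j = b i ℕ.+ b j

  -- The pair kernel has degree at most `b i` in x_i and `β i j` in x_j, and division by a
  -- difference of letters of the two groups lowers both by one.
  record PairFactor (i j : Fin n) (k l : ℕ) : Set where
    field
      ρ      : Poly n
      factors : monoP (qpow (B i j)) *P pairKernel i j ≈ (val i k +P negP (val j l)) *P ρ
      at-i   : (λ e → lookup e i) ⊢ ρ ≤ + b i ℤ.- 1ℤ
      at-j   : (λ e → lookup e j) ⊢ ρ ≤ + β i j ℤ.- 1ℤ
      other  : ∀ {m} → m ≢ i → m ≢ j → (λ e → lookup e m) ⊢ ρ ≤ 0ℤ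

  module _ {i j : Fin n} (i≢j : i ≢ j) where

    ratio-at-i : lookup (proj₂ (ratio i j)) i ≡ 1ℤ
    ratio-at-i = trans (ratio-lookup i j i) (cong₂ ℤ._-_ (unitV-≡ i) (unitV-≢ i≢j))

    ratio-at-j : lookup (proj₂ (ratio i j)) j ≡ -1ℤ
    ratio-at-j = trans (ratio-lookup i j j) (cong₂ ℤ._-_ (unitV-≢ (λ z → i≢j (sym z))) (unitV-≡ j))

    ratio-other : ∀ {m} → m ≢ i → m ≢ j → lookup (proj₂ (ratio i j)) m ≡ 0ℤ
    ratio-other {m} m≢i m≢j = trans (ratio-lookup i j m) (cong₂ ℤ._-_ (unitV-≢ m≢i) (unitV-≢ m≢j))

  q*-≤ : ∀ {ℓ : Vec ℤ n → ℤ} {c} {z : Vec ℤ n} → ℓ z ℤ.≤ c → ℓ (zipWith ℤ._+_ (replicate n 0ℤ) z) ℤ.≤ c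
  q*-≤ {ℓ} {c} {z} p = subst (λ w → ℓ w ℤ.≤ c) (sym (0+ z)) p

  neg-at : ∀ (i : Fin n) → lookup (negUnitV i) i ≡ -1ℤ
  neg-at i = trans (negUnitV-lookup i i) (cong ℤ.-_ (unitV-≡ i))

  neg-other : ∀ {i m : Fin n} → m ≢ i → lookup (negUnitV i) m ≡ 0ℤ
  neg-other {i} {m} m≢i = trans (negUnitV-lookup i m) (cong ℤ.-_ (unitV-≢ m≢i))

  pred-≡ : ∀ {m} → 1 ℕ.≤ m → + (m ∸ 1) ≡ + m ℤ.- 1ℤ
  pred-≡ (ℕ.s≤s _) = refl

  -1+ : ∀ m → -1ℤ ℤ.+ + m ≡ + m ℤ.- 1ℤ
  -1+ m = ℤₚ.+-comm -1ℤ (+ m)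

  -- The factor of the kernel proportional to x_i q^k − x_j q^l lies in the second
  -- q-shifted factorial if k < l and in the first one otherwise.
  pairFactor : ∀ {i j k l} → toℕ i ℕ.< toℕ j → k ℕ.< b i → l ℕ.< b j → PairFactor i j k l
  pairFactor {i} {j} {k} {l} i<j k<bᵢ l<bⱼ with k ℕ.<? l
  ... | yes k<l with ℕₚ.m≤n⇒∃[o]m+o≡n k<l
  ...   | t , refl = record
    { ρ = monoP s *P (P₁ *P R)
    ; factors = ≈-trans (*P-cong (≈-refl {P = monoP (qpow (B i j))})
          (≈-trans (*P-cong (≈-refl {P = P₁}) P₂≈) (*-swap P₁ (factor (mulMono (qpow 1) (ratio j i)) t) R)))
        (binomial-factor (monoP (qpow (B i j))) oneP (monoP (mulMono (mulMono (qpow 1) (ratio j i)) (qpow t)))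
            (val i k) (val j l) (monoP s) (P₁ *P R)
          (≈-reflexive (cong monoP (letter-cancel i k≤B)))
          (≈-reflexive (cong monoP (q-ratio-letters j i t k≤B))))
    ; at-i = bound-weaken (ℤₚ.≤-reflexive (trans (cong₂ (λ x y → -1ℤ ℤ.+ + (x ℕ.+ y)) (ℕₚ.*-identityʳ (b i))
                 (ℕₚ.*-zeroʳ (β i j ∸ 1))) (trans (cong (λ x → -1ℤ ℤ.+ + x) (ℕₚ.+-identityʳ (b i))) (-1+ (b i)))))
        (bnd (lookup-additive i) (ℤₚ.≤-reflexive (neg-at i)) {1} {0} (ℤₚ.≤-reflexive (ratio-at-i i≢j))
          (ℤₚ.≤-trans (ℤₚ.≤-reflexive (ratio-at-j j≢i)) ℤ.-≤+))
    ; at-j = bound-weaken (ℤₚ.≤-reflexive (trans (cong₂ (λ x y → 0ℤ ℤ.+ + (x ℕ.+ y)) (ℕₚ.*-zeroʳ (b i))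
                 (ℕₚ.*-identityʳ (β i j ∸ 1))) (pred-≡ (ℕₚ.≤-trans (ℕ.s≤s ℕ.z≤n) t<β))))
        (bnd (lookup-additive j) (ℤₚ.≤-reflexive (neg-other j≢i)) {0} {1}
          (ℤₚ.≤-trans (ℤₚ.≤-reflexive (ratio-at-j i≢j)) ℤ.-≤+) (ℤₚ.≤-reflexive (ratio-at-i j≢i)))
    ; other = λ {m} m≢i m≢j → bound-weaken (ℤₚ.≤-reflexive (cong₂ (λ x y → 0ℤ ℤ.+ + (x ℕ.+ y)) (ℕₚ.*-zeroʳ (b i))
                 (ℕₚ.*-zeroʳ (β i j ∸ 1))))
        (bnd (lookup-additive m) (ℤₚ.≤-reflexive (neg-other m≢i)) {0} {0}
          (ℤₚ.≤-reflexive (ratio-other i≢j m≢i m≢j)) (ℤₚ.≤-reflexive (ratio-other j≢i m≢j m≢i)))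
    }
    where
    i≢j : i ≢ j
    i≢j i≡j = ℕₚ.<-irrefl (cong toℕ i≡j) i<j
    j≢i : j ≢ i
    j≢i j≡i = i≢j (sym j≡i)
    k≤B : k ℕ.≤ B i j
    k≤B = ℕₚ.≤-trans (ℕₚ.<⇒≤ k<bᵢ) (ℕₚ.m≤m+n (b i) (b j))
    s : Mono n
    s = (B i j ∸ k , negUnitV i)
    P₁ : Poly n
    P₁ = qPoch (ratio i j) (b i)
    t<β : t ℕ.< β i j
    -- `b j` may exceed `β i j` by one. The factor q in the second q-factorial makes up for it: l =
    -- k + 1 + t < `b j` still forces t < `β i j`.
    t<β = ℕₚ.≤-pred (ℕₚ.≤-trans (ℕ.s≤s (ℕ.s≤s (ℕₚ.m≤n+m t k))) (ℕₚ.≤-trans l<bⱼ (b≤1+β i j)))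
    open Σ (qPoch-factor (mulMono (qpow 1) (ratio j i)) t<β) renaming (proj₁ to R; proj₂ to R-props)
    P₂≈ : qPoch (mulMono (qpow 1) (ratio j i)) (β i j) ≈ factor (mulMono (qpow 1) (ratio j i)) t *P R
    P₂≈ = proj₁ R-props
    bnd : ∀ {ℓ} → Additive ℓ → ∀ {c} → ℓ (negUnitV i) ℤ.≤ c → ∀ {d₁ d₂} →
      ℓ (proj₂ (ratio i j)) ℤ.≤ + d₁ → ℓ (proj₂ (ratio j i)) ℤ.≤ + d₂ →
      ℓ ⊢ monoP s *P (P₁ *P R) ≤ c ℤ.+ + (b i ℕ.* d₁ ℕ.+ (β i j ∸ 1) ℕ.* d₂)
    bnd {ℓ} add p p₁ p₂ = bound-* add (bound-monoP p)
      (bound-* add (bound-qPoch add p₁ (b i)) (proj₂ R-props add (q*-≤ {ℓ} p₂)))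
  pairFactor {i} {j} {k} {l} i<j k<bᵢ l<bⱼ | no k≮l with ℕₚ.m≤n⇒∃[o]m+o≡n (ℕₚ.≮⇒≥ k≮l)
  ...   | t , refl = record
    -- The factor 1 - (x_i / x_j) q^t is proportional to x_j q^l - x_i q^k, the opposite of the
    -- required difference; hence the sign.
    { ρ = negP (monoP s *P (R *P P₂))
    ; factors = ≈-trans (*P-cong (≈-refl {P = monoP (qpow (B i j))})
          (≈-trans (*P-cong P₁≈ (≈-refl {P = P₂})) (*P-assoc (factor (ratio i j) t) R P₂)))
        (≈-trans (binomial-factor (monoP (qpow (B i j))) oneP (monoP (mulMono (ratio i j) (qpow t)))
            (val j l) (val i k) (monoP s) (R *P P₂)
            (≈-reflexive (cong monoP (letter-cancel j l≤B)))
            (≈-reflexive (cong monoP (ratio-letters i j t l≤B))))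
          (neg-diff (val j l) (val i (l ℕ.+ t)) (monoP s *P (R *P P₂))))
    ; at-i = bound-neg (bound-weaken (ℤₚ.≤-reflexive (trans (cong₂ (λ x y → 0ℤ ℤ.+ + (x ℕ.+ y)) (ℕₚ.*-identityʳ (b i ∸ 1))
                 (ℕₚ.*-zeroʳ (β i j))) (trans (cong +_ (ℕₚ.+-identityʳ (b i ∸ 1))) (pred-≡ (ℕₚ.≤-trans (ℕ.s≤s ℕ.z≤n) k<bᵢ)))))
        (bnd (lookup-additive i) (ℤₚ.≤-reflexive (neg-other i≢j)) {1} {0} (ℤₚ.≤-reflexive (ratio-at-i i≢j))
          (ℤₚ.≤-trans (ℤₚ.≤-reflexive (ratio-at-j j≢i)) ℤ.-≤+)))
    ; at-j = bound-neg (bound-weaken (ℤₚ.≤-reflexive (trans (cong₂ (λ x y → -1ℤ ℤ.+ + (x ℕ.+ y)) (ℕₚ.*-zeroʳ (b i ∸ 1))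
                 (ℕₚ.*-identityʳ (β i j))) (-1+ (β i j))))
        (bnd (lookup-additive j) (ℤₚ.≤-reflexive (neg-at j)) {0} {1}
          (ℤₚ.≤-trans (ℤₚ.≤-reflexive (ratio-at-j i≢j)) ℤ.-≤+) (ℤₚ.≤-reflexive (ratio-at-i j≢i))))
    ; other = λ {m} m≢i m≢j → bound-neg (bound-weaken (ℤₚ.≤-reflexive (cong₂ (λ x y → 0ℤ ℤ.+ + (x ℕ.+ y))
                 (ℕₚ.*-zeroʳ (b i ∸ 1)) (ℕₚ.*-zeroʳ (β i j))))
        (bnd (lookup-additive m) (ℤₚ.≤-reflexive (neg-other m≢j)) {0} {0}
          (ℤₚ.≤-reflexive (ratio-other i≢j m≢i m≢j)) (ℤₚ.≤-reflexive (ratio-other j≢i m≢j m≢i))))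
    }
    where
    i≢j : i ≢ j
    i≢j i≡j = ℕₚ.<-irrefl (cong toℕ i≡j) i<j
    j≢i : j ≢ i
    j≢i j≡i = i≢j (sym j≡i)
    l≤B : l ℕ.≤ B i j
    l≤B = ℕₚ.≤-trans (ℕₚ.<⇒≤ l<bⱼ) (ℕₚ.m≤n+m (b j) (b i))
    s : Mono n
    s = (B i j ∸ l , negUnitV j)
    P₂ : Poly n
    P₂ = qPoch (mulMono (qpow 1) (ratio j i)) (β i j)
    t<b : t ℕ.< b i
    t<b = ℕₚ.≤-trans (ℕ.s≤s (ℕₚ.m≤n+m t l)) k<bᵢ
    open Σ (qPoch-factor (ratio i j) t<b) renaming (proj₁ to R; proj₂ to R-props)
    P₁≈ : qPoch (ratio i j) (b i) ≈ factor (ratio i j) t *P R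
    P₁≈ = proj₁ R-props
    bnd : ∀ {ℓ} → Additive ℓ → ∀ {c} → ℓ (negUnitV j) ℤ.≤ c → ∀ {d₁ d₂} →
      ℓ (proj₂ (ratio i j)) ℤ.≤ + d₁ → ℓ (proj₂ (ratio j i)) ℤ.≤ + d₂ →
      ℓ ⊢ monoP s *P (R *P P₂) ≤ c ℤ.+ + ((b i ∸ 1) ℕ.* d₁ ℕ.+ β i j ℕ.* d₂)
    bnd {ℓ} add p p₁ p₂ = bound-* add (bound-monoP p)
      (bound-* add (proj₂ R-props add p₁) (bound-qPoch add (q*-≤ {ℓ} p₂) (β i j)))

  -- The kernel factor of the pair {i, j}, scaled by a power of q so that the quotients ρ below
  -- need no negative power of q, and 0 on the diagonal so that κ-factor also holds for two
  -- letters of the same group.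
  κ : Fin n → Fin n → Poly n
  κ i j with ℕₚ.<-cmp (toℕ i) (toℕ j)
  ... | tri< _ _ _ = monoP (qpow (B i j)) *P pairKernel i j
  ... | tri≈ _ _ _ = zeroP
  ... | tri> _ _ _ = monoP (qpow (B j i)) *P pairKernel j i

  κ-sym : ∀ i j → κ i j ≈ κ j i
  κ-sym i j with ℕₚ.<-cmp (toℕ i) (toℕ j) | ℕₚ.<-cmp (toℕ j) (toℕ i)
  ... | tri< _ _ _   | tri> _ _ _   = ≈-refl
  ... | tri> _ _ _   | tri< _ _ _   = ≈-refl
  ... | tri≈ _ _ _   | tri≈ _ _ _   = ≈-refl
  ... | tri< i<j _ _ | tri< j<i _ _ = contradiction i<j (ℕₚ.<-asym j<i)
  ... | tri< _ i≢j _ | tri≈ _ j≡i _ = contradiction (sym j≡i) i≢j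
  ... | tri> _ _ j<i | tri> _ _ i<j = contradiction i<j (ℕₚ.<-asym j<i)
  ... | tri> _ i≢j _ | tri≈ _ j≡i _ = contradiction (sym j≡i) i≢j
  ... | tri≈ _ i≡j _ | tri< _ j≢i _ = contradiction (sym i≡j) j≢i
  ... | tri≈ _ i≡j _ | tri> _ j≢i _ = contradiction (sym i≡j) j≢i

  -- The bound on the power of q is part of the item because `pairFactor`, through which `ρ` is
  -- defined, requires it.
  Item : Set
  Item = Σ (Fin n) (λ i → Fin (b i))

  itemVal : Item → Poly n
  itemVal (i , k) = val i (toℕ k)

  ρ : Item → Item → Poly n
  ρ (i , k) (j , l) with ℕₚ.<-cmp (toℕ i) (toℕ j)
  ... | tri< i<j _ _ = PairFactor.ρ (pairFactor i<j (Finₚ.toℕ<n k) (Finₚ.toℕ<n l))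
  ... | tri≈ _ _ _   = zeroP
  ... | tri> _ _ j<i = negP (PairFactor.ρ (pairFactor j<i (Finₚ.toℕ<n l) (Finₚ.toℕ<n k)))

  κ-factor : ∀ x y → κ (proj₁ x) (proj₁ y) ≈ (itemVal x +P negP (itemVal y)) *P ρ x y
  κ-factor (i , k) (j , l) with ℕₚ.<-cmp (toℕ i) (toℕ j)
  ... | tri< i<j _ _ = PairFactor.factors (pairFactor i<j (Finₚ.toℕ<n k) (Finₚ.toℕ<n l))
  ... | tri≈ _ _ _   = ≈-refl
  ... | tri> _ _ j<i = ≈-trans (PairFactor.factors (pairFactor j<i (Finₚ.toℕ<n l) (Finₚ.toℕ<n k)))
    (neg-diff (val j (toℕ l)) (val i (toℕ k)) (PairFactor.ρ (pairFactor j<i (Finₚ.toℕ<n l) (Finₚ.toℕ<n k))))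

  -- If the first index is the smaller one, ε is saved by the shorter second q-factorial. In the
  -- opposite order χ is antitone, so ε is 0 and the first q-factorial gives the bound.
  ρ-bound : ∀ x y → (λ e → lookup e (proj₁ y)) ⊢ ρ x y ≤ (+ b (proj₁ y) ℤ.- 1ℤ) ℤ.- ε (proj₁ x) (proj₁ y)
  ρ-bound (i , k) (j , l) with ℕₚ.<-cmp (toℕ i) (toℕ j)
  ... | tri< i<j _ _ = bound-weaken (β-ε i<j) (PairFactor.at-j (pairFactor i<j (Finₚ.toℕ<n k) (Finₚ.toℕ<n l)))
  ... | tri≈ _ _ _   = bounded []
  ... | tri> _ _ j<i = bound-weaken
    (ℤₚ.≤-reflexive (sym (trans (cong (λ z → (+ b j ℤ.- 1ℤ) ℤ.- z) (ε-zero (χ-antitone j<i))) (ℤₚ.+-identityʳ _))))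
    (bound-neg (PairFactor.at-i (pairFactor j<i (Finₚ.toℕ<n l) (Finₚ.toℕ<n k))))

  ρ-bound-other : ∀ x y {m} → m ≢ proj₁ x → m ≢ proj₁ y → (λ e → lookup e m) ⊢ ρ x y ≤ 0ℤ
  ρ-bound-other (i , k) (j , l) m≢i m≢j with ℕₚ.<-cmp (toℕ i) (toℕ j)
  ... | tri< i<j _ _ = PairFactor.other (pairFactor i<j (Finₚ.toℕ<n k) (Finₚ.toℕ<n l)) m≢i m≢j
  ... | tri≈ _ _ _   = bounded []
  ... | tri> _ _ j<i = bound-neg (PairFactor.other (pairFactor j<i (Finₚ.toℕ<n l) (Finₚ.toℕ<n k)) m≢j m≢i)

  κ-bound : ∀ {ℓ} → Additive ℓ → ∀ i j {d₁ d₂} →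
    ℓ (proj₂ (ratio i j)) ℤ.≤ + d₁ → ℓ (proj₂ (ratio j i)) ℤ.≤ + d₂ →
    ℓ ⊢ κ i j ≤ + (b i ℕ.* d₁ ℕ.+ b j ℕ.* d₂)
  κ-bound {ℓ} add i j {d₁} {d₂} p₁ p₂ with ℕₚ.<-cmp (toℕ i) (toℕ j)
  ... | tri< i<j _ _ = bound-weaken (ℤ.+≤+ (ℕₚ.+-monoʳ-≤ (b i ℕ.* d₁) (ℕₚ.*-monoˡ-≤ d₂ (β≤b i<j))))
    (bound-* add (bound-qpow add (B i j)) (bound-* add (bound-qPoch add p₁ (b i)) (bound-qPoch add (q*-≤ {ℓ} p₂) (β i j))))
  ... | tri≈ _ _ _   = bounded []
  ... | tri> _ _ j<i = bound-weaken (ℤₚ.≤-trans (ℤ.+≤+ (ℕₚ.+-monoʳ-≤ (b j ℕ.* d₂) (ℕₚ.*-monoˡ-≤ d₁ (β≤b j<i))))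
      (ℤₚ.≤-reflexive (cong +_ (ℕₚ.+-comm (b j ℕ.* d₂) (b i ℕ.* d₁)))))
    (bound-* add (bound-qpow add (B j i)) (bound-* add (bound-qPoch add p₂ (b j)) (bound-qPoch add (q*-≤ {ℓ} p₁) (β j i))))

  ρ-antisym : ∀ x y → ρ x y ≈ negP (ρ y x)
  ρ-antisym (i , k) (j , l) with ℕₚ.<-cmp (toℕ i) (toℕ j) | ℕₚ.<-cmp (toℕ j) (toℕ i)
  -- The two comparisons yield two proofs of one inequality, and the quotient taken from
  -- `pairFactor` mentions the proof.
  ... | tri< i<j _ _ | tri> _ _ i<j′ with refl ← ℕₚ.<-irrelevant i<j i<j′ =
    neg-neg (PairFactor.ρ (pairFactor i<j (Finₚ.toℕ<n k) (Finₚ.toℕ<n l)))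
  ... | tri> _ _ j<i | tri< j<i′ _ _ with refl ← ℕₚ.<-irrelevant j<i j<i′ = ≈-refl
  ... | tri≈ _ _ _   | tri≈ _ _ _   = ≈-refl
  ... | tri< i<j _ _ | tri< j<i _ _ = contradiction i<j (ℕₚ.<-asym j<i)
  ... | tri< _ i≢j _ | tri≈ _ j≡i _ = contradiction (sym j≡i) i≢j
  ... | tri> _ _ j<i | tri> _ _ i<j = contradiction i<j (ℕₚ.<-asym j<i)
  ... | tri> _ i≢j _ | tri≈ _ j≡i _ = contradiction (sym j≡i) i≢j
  ... | tri≈ _ i≡j _ | tri< _ j≢i _ = contradiction (sym i≡j) j≢i
  ... | tri≈ _ i≡j _ | tri> _ j≢i _ = contradiction (sym i≡j) j≢i

-- Reduction to one letter per group

unique-↭ : ∀ {a} {A : Set a} {xs ys : List A} → xs ↭ ys → Unique xs → Unique ys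
unique-↭ Perm.refl        u                         = u
unique-↭ (prep x p)       (x∉ ∷ u)                  = Permₚ.All-resp-↭ p x∉ ∷ unique-↭ p u
unique-↭ (swap x y p)     ((x≢y ∷ x∉) ∷ (y∉ ∷ u)) =
  ((λ y≡x → x≢y (sym y≡x)) ∷ Permₚ.All-resp-↭ p y∉) ∷ (Permₚ.All-resp-↭ p x∉ ∷ unique-↭ p u)
unique-↭ (Perm.trans p q) u                         = unique-↭ q (unique-↭ p u)

module _ {n : ℕ} where

  open RingLemmas (polyRing n)
  module LetterComplete = Complete {A = Mono n} monoP h h-zero h-nil h-suc
  open CommutativeRing (polyRing n) using (*-assoc)

  hλ-↭ : ∀ {Y Y′ : List (Mono n)} → Y ↭ Y′ → ∀ μ → hλ μ Y ≈ hλ μ Y′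
  hλ-↭ p []      = ≈-refl
  hλ-↭ p (r ∷ μ) = *P-cong (LetterComplete.h-↭ p r) (hλ-↭ p μ)

  supported-monoP : ∀ {Q Q′ : Vec ℤ n → Set} (y : Mono n) {P} → (∀ {u} → Q′ u → Q (zipWith ℤ._+_ (proj₂ y) u)) →
    Supported Q′ P → Supported Q (monoP y *P P)
  supported-monoP y {P} shift = supported-* {P = monoP y} {R = P} λ { (here refl) → shift ; (there ()) }

  Stable : (Vec ℤ n → Set) → Mono n → Set
  Stable Q y = ∀ {u} → Q u → Q (zipWith ℤ._+_ (proj₂ y) u)

  -- Iterating h_r(y, Z) = h_r(Z) + y h_(r-1)(y, Z) leaves powers of y times h_r′(Z) with r′ ≤ r,
  -- and multiplication by y preserves `Q`.
  h-peel : ∀ {Q y} → Stable Q y → ∀ Z E r →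
    (∀ {r′} → r′ ℕ.≤ r → Supported Q (h r′ Z *P E)) → Supported Q (h r (y ∷ Z) *P E)
  h-peel {y = y} st Z E zero    s =
    supported-≈ (*P-cong (≈-trans (h-zero Z) (≈-sym (h-zero (y ∷ Z)))) (≈-refl {P = E})) (s ℕ.z≤n)
  h-peel {y = y} st Z E (suc r) s = supported-≈
    (≈-sym (≈-trans (*P-cong (h-suc r y Z) (≈-refl {P = E}))
      (≈-trans (*P-distribʳ E (h (suc r) Z) (monoP y *P h r (y ∷ Z)))
        (+P-cong (≈-refl {P = h (suc r) Z *P E}) (*-assoc (monoP y) (h r (y ∷ Z)) E)))))
    (supported-+ (s ℕₚ.≤-refl)
      (supported-monoP y st (h-peel st Z E r (λ r′≤r → s (ℕₚ.m≤n⇒m≤1+n r′≤r)))))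

  hλ-peel₁ : ∀ {Q y} → Stable Q y → ∀ Z μ E →
    (∀ {μ′} → Pointwise ℕ._≤_ μ′ μ → Supported Q (hλ μ′ Z *P E)) → Supported Q (hλ μ (y ∷ Z) *P E)
  hλ-peel₁ st Z []      E s = s []
  hλ-peel₁ {y = y} st Z (r ∷ μ) E s =
    supported-≈ (≈-sym (*-assoc (h r (y ∷ Z)) (hλ μ (y ∷ Z)) E))
      (h-peel st Z (hλ μ (y ∷ Z) *P E) r λ {r′} r′≤r →
        supported-≈ (*-swap (hλ μ (y ∷ Z)) (h r′ Z) E)
          (hλ-peel₁ st Z μ (h r′ Z *P E) λ {μ′} μ′≤μ →
            supported-≈ (*-move (h r′ Z) (hλ μ′ Z) E) (s (r′≤r ∷ μ′≤μ))))

  -- Meant for `Y` the letters of the group just selected: `Q` then no longer looks at the exponent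
  -- of its variable and is stable under all of them.
  hλ-peel : ∀ {Q Y} → All (Stable Q) Y → ∀ Z μ E →
    (∀ {μ′} → Pointwise ℕ._≤_ μ′ μ → Supported Q (hλ μ′ Z *P E)) → Supported Q (hλ μ (Y ++ Z) *P E)
  hλ-peel []        Z μ E s = s (Pointwise.refl ℕₚ.≤-refl)
  hλ-peel {Y = y ∷ Y} (st ∷ sts) Z μ E s = hλ-peel₁ st (Y ++ Z) μ E λ {μ′} μ′≤μ →
    hλ-peel sts Z μ′ E λ μ″≤μ′ → s (Pointwise.transitive ℕₚ.≤-trans μ″≤μ′ μ′≤μ)

  Below : (Vec ℤ n → ℤ) → ℤ → Vec ℤ n → Set
  Below ℓ c u = ℓ u ℤ.≤ c

  module _ {ℓ : Vec ℤ n → ℤ} (add : Additive ℓ) where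

    h-below : ∀ {Y} → All (λ y → ℓ (proj₂ y) ℤ.≤ 1ℤ) Y → ∀ r {E c} →
      Supported (Below ℓ c) E → Supported (Below ℓ (+ r ℤ.+ c)) (h r Y *P E)
    h-below {Y} _ zero {E} {c} s = supported-≈
      (≈-trans (≈-sym (*P-identityˡ E)) (*P-cong (≈-sym (h-zero Y)) (≈-refl {P = E})))
      (subst (λ d → Supported (Below ℓ d) E) (sym (ℤₚ.+-identityˡ c)) s)
    h-below []                  (suc r) s = supported-zero
    h-below {y ∷ Y} (p ∷ ps) (suc r) {E} {c} s = supported-≈
      (≈-sym (≈-trans (*P-cong (h-suc r y Y) (≈-refl {P = E}))
        (≈-trans (*P-distribʳ E (h (suc r) Y) (monoP y *P h r (y ∷ Y)))
          (+P-cong (≈-refl {P = h (suc r) Y *P E}) (*-assoc (monoP y) (h r (y ∷ Y)) E)))))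
      (supported-+ (h-below ps (suc r) s)
        (supported-monoP y (λ {u} ℓu≤ → ℤₚ.≤-trans (ℤₚ.≤-reflexive (ℓ-+ add (proj₂ y) u))
              (ℤₚ.≤-trans (ℤₚ.+-mono-≤ p ℓu≤) (ℤₚ.≤-reflexive (sym (ℤₚ.+-assoc 1ℤ (+ r) c)))))
          (h-below (p ∷ ps) r s)))

    hλ-below : ∀ {Y} → All (λ y → ℓ (proj₂ y) ℤ.≤ 1ℤ) Y → ∀ μ {E c} →
      Supported (Below ℓ c) E → Supported (Below ℓ (+ (sumℕ μ) ℤ.+ c)) (hλ μ Y *P E)
    hλ-below     p []      {E} {c} s = supported-≈ (≈-sym (*P-identityˡ E))
      (subst (λ d → Supported (Below ℓ d) E) (sym (ℤₚ.+-identityˡ c)) s)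
    hλ-below {Y} p (r ∷ μ) {E} {c} s = supported-≈ (≈-sym (*-assoc (h r Y) (hλ μ Y) E))
      (subst (λ d → Supported (Below ℓ d) (h r Y *P (hλ μ Y *P E))) (sym (ℤₚ.+-assoc (+ r) (+ (sumℕ μ)) c))
        (h-below p r (hλ-below p μ s)))

    hλ-[]-bound : ∀ μ → ℓ ⊢ hλ μ [] ≤ 0ℤ
    hλ-[]-bound []          = bound-oneP add
    hλ-[]-bound (zero ∷ μ)  = bound-* add (bound-oneP add) (hλ-[]-bound μ)
    hλ-[]-bound (suc r ∷ μ) = bounded []

    bound-pow : ∀ {P} → ℓ ⊢ P ≤ 0ℤ → ∀ k → ℓ ⊢ pow P k ≤ 0ℤ
    bound-pow p zero    = bound-oneP add
    bound-pow p (suc k) = bound-* add p (bound-pow p k)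

    bound-pow-neg : ∀ {P} → ℓ ⊢ P ≤ -1ℤ → ∀ k → ℓ ⊢ pow P k ≤ ℤ.- (+ k)
    bound-pow-neg p zero    = bound-oneP add
    bound-pow-neg p (suc k) = bound-weaken (ℤₚ.≤-reflexive (sym (ℤₚ.neg-distrib-+ 1ℤ (+ k))))
      (bound-* add p (bound-pow-neg p k))

    bound-∏₂ : ∀ {a} {A : Set a} (κ : A → A → Poly n) {xs} → (∀ {x y} → x ∈ xs → y ∈ xs → ℓ ⊢ κ x y ≤ 0ℤ) →
      ℓ ⊢ ∏₂ κ xs ≤ 0ℤ
    bound-∏₂ κ {[]}     p = bound-oneP add
    bound-∏₂ κ {x ∷ xs} p = bound-* add (bound-∏≤0 add (κ x) (λ y∈ → p (here refl) (there y∈)))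
      (bound-∏₂ κ (λ x∈ y∈ → p (there x∈) (there y∈)))

  xi⁻¹ : Fin n → Poly n
  xi⁻¹ i = monoP (0 , negUnitV i)

  xM-inverse : ∀ i → monoP (xM i) *P xi⁻¹ i ≈ oneP
  xM-inverse i = ≈-reflexive (cong (λ e → monoP (0 , e)) (vec-ext λ m →
    trans (Vecₚ.lookup-zipWith ℤ._+_ m (unitV i) (negUnitV i))
      (trans (cong (λ z → lookup (unitV i) m ℤ.+ z) (negUnitV-lookup i m))
        (trans (ℤₚ.+-inverseʳ (lookup (unitV i) m)) (sym (Vecₚ.lookup-replicate m 0ℤ))))))

  -- (x_i q^k − x_i q^l) h_r(…, x_i q^k, x_i q^l) is a difference of complete functions of smaller
  -- alphabets, and the scalar q^k − q^l can be cancelled.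
  group-reduction : ∀ {Q} i k ks → Unique (k ∷ ks) → ∀ r Z E →
    (∀ {l} → l ∈ k ∷ ks → ∀ r′ → Supported Q (h r′ (letter i l ∷ Z) *P (pow (xi⁻¹ i) (length ks) *P E))) →
    Supported Q (h r (List.map (letter i) (k ∷ ks) ++ Z) *P E)
  group-reduction i k []       _ r Z E s =
    supported-≈ (*P-cong (≈-refl {P = h r (letter i k ∷ Z)}) (*P-identityˡ E)) (s (here refl) r)
  group-reduction {Q} i k (l ∷ ks) ((k≢l ∷ k∉) ∷ (l∉ ∷ u)) r Z E s = torsion k≢l (supported-≈
      (pow-unit-step {monoP (xM i)} {xi⁻¹ i} {monoP (qpow k)} {monoP (qpow l)} {monoP (letter i k)} {monoP (letter i l)}
        (h r (letter i k ∷ letter i l ∷ Y)) (h (suc r) (letter i k ∷ Y)) (h (suc r) (letter i l ∷ Y)) E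
        (xM-inverse i) ≈-refl ≈-refl (LetterComplete.h-divided-difference r (letter i k) (letter i l) Y))
      (supported-+
        (group-reduction i k ks (k∉ ∷ u) (suc r) Z (xi⁻¹ i *P E) (λ l∈ r′ → shift r′ (s (keep l∈) r′)))
        (supported-neg
          (group-reduction i l ks (l∉ ∷ u) (suc r) Z (xi⁻¹ i *P E) (λ l∈ r′ → shift r′ (s (there l∈) r′))))))
    where
    Y : List (Mono n)
    Y = List.map (letter i) ks ++ Z
    keep : ∀ {l′} → l′ ∈ k ∷ ks → l′ ∈ k ∷ l ∷ ks
    keep (here p)   = here p
    keep (there l∈) = there (there l∈)
    shift : ∀ r′ {y} →
      Supported Q (h r′ (y ∷ Z) *P ((xi⁻¹ i *P pow (xi⁻¹ i) (length ks)) *P E)) →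
      Supported Q (h r′ (y ∷ Z) *P (pow (xi⁻¹ i) (length ks) *P (xi⁻¹ i *P E)))
    shift r′ {y} = supported-≈ (*P-cong (≈-refl {P = h r′ (y ∷ Z)}) (*-move (xi⁻¹ i) (pow (xi⁻¹ i) (length ks)) E))

module Groups {n : ℕ} (n₀ : ℕ) (a : Vec ℕ n) (a-pos : ∀ i → 1 ℕ.≤ lookup a i) where

  open Kernel n₀ a a-pos
  open RingLemmas (polyRing n)

  X : List (Fin n) → List (Mono n)
  X = concatMap (λ i → List.map (letter i) (upTo (b i)))

  X-↭ : ∀ {S S′} → S ↭ S′ → X S ↭ X S′
  X-↭ Perm.refl        = Perm.refl
  X-↭ (prep i p)       = Permₚ.++⁺ˡ (List.map (letter i) (upTo (b i))) (X-↭ p)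
  X-↭ (swap i j p)     = Perm.trans (Permₚ.shifts (List.map (letter i) (upTo (b i))) (List.map (letter j) (upTo (b j))))
    (Permₚ.++⁺ˡ (List.map (letter j) (upTo (b j))) (Permₚ.++⁺ˡ (List.map (letter i) (upTo (b i))) (X-↭ p)))
  X-↭ (Perm.trans p q) = Perm.trans (X-↭ p) (X-↭ q)

  letterOf : Item → Mono n
  letterOf (i , k) = letter i (toℕ k)

  -- Reducing `b i` letters to one takes b i - 1 divided differences, and each contributes one
  -- inverse of x_i.
  groupMono : Fin n → Poly n
  groupMono i = pow (xi⁻¹ i) (b i ∸ 1)

  first-group : ∀ {Q} i → 1 ℕ.≤ b i → ∀ r Z E →
    (∀ (k : Fin (b i)) r′ → Supported Q (h r′ (letterOf (i , k) ∷ Z) *P (groupMono i *P E))) →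
    Supported Q (h r (List.map (letter i) (upTo (b i)) ++ Z) *P E)
  first-group {Q} i 1≤b r Z E s = go (b i) refl 1≤b
    where
    go : ∀ c → c ≡ b i → 1 ℕ.≤ c → Supported Q (h r (List.map (letter i) (upTo c) ++ Z) *P E)
    go (suc c) eq _ = group-reduction i 0 (applyUpTo suc c) (upTo⁺ (suc c)) r Z E λ {l} l∈ r′ →
      subst₂ (λ l e → Supported Q (h r′ (letter i l ∷ Z) *P (pow (xi⁻¹ i) e *P E)))
        (Finₚ.toℕ-fromℕ< (subst (l ℕ.<_) eq (∈-upTo⁻ l∈)))
        (trans (cong (_∸ 1) (sym eq)) (sym (Listₚ.length-applyUpTo suc c)))
        (s (fromℕ< (subst (l ℕ.<_) eq (∈-upTo⁻ l∈))) r′)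

  -- The hypothesis must cover all degrees r because every divided difference raises the degree. `W`
  -- collects the letters already chosen.
  groups-reduction : ∀ {Q} T → All (λ i → 1 ℕ.≤ b i) T → ∀ W E →
    (∀ ks → List.map proj₁ ks ≡ T → ∀ r → Supported Q (h r (List.map letterOf ks ++ W) *P (∏ groupMono T *P E))) →
    ∀ r → Supported Q (h r (X T ++ W) *P E)
  groups-reduction []      []         W E s r =
    supported-≈ (*P-cong (≈-refl {P = h r W}) (*P-identityˡ E)) (s [] refl r)
  groups-reduction {Q} (i ∷ T) (1≤b ∷ pos) W E s r =
    subst (λ Y → Supported Q (h r Y *P E)) (sym (Listₚ.++-assoc (List.map (letter i) (upTo (b i))) (X T) W))
      (first-group i 1≤b r (X T ++ W) E λ k r′ →
        supported-≈ (*P-cong (LetterComplete.h-↭ (Permₚ.shift (letterOf (i , k)) (X T) W) r′) (≈-refl {P = groupMono i *P E}))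
          (groups-reduction T pos (letterOf (i , k) ∷ W) (groupMono i *P E)
            (λ ks eq r″ → supported-≈
              (*P-cong (≈-sym (LetterComplete.h-↭ (Permₚ.shift (letterOf (i , k)) (List.map letterOf ks) W) r″))
                (*-move (groupMono i) (∏ groupMono T) E))
              (s ((i , k) ∷ ks) (cong (i ∷_) eq) r″)) r′))

-- Induction on the number of complete symmetric functions expanded

sumAt : ∀ {n} → List (Fin n) → Vec ℤ n → ℤ
sumAt []      u = 0ℤ
sumAt (j ∷ J) u = lookup u j ℤ.+ sumAt J u

+-interchange : ∀ x y z w → (x ℤ.+ y) ℤ.+ (z ℤ.+ w) ≡ (x ℤ.+ z) ℤ.+ (y ℤ.+ w)
+-interchange = ℤ-solve

sumAt-additive : ∀ {n} (J : List (Fin n)) → Additive (sumAt J)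
sumAt-additive []      = record { ℓ-zero = refl ; ℓ-+ = λ e f → refl }
sumAt-additive (j ∷ J) = record
  { ℓ-zero = cong₂ ℤ._+_ (ℓ-zero (lookup-additive j)) (ℓ-zero (sumAt-additive J))
  ; ℓ-+    = λ e f → trans (cong₂ ℤ._+_ (ℓ-+ (lookup-additive j) e f) (ℓ-+ (sumAt-additive J) e f))
      (+-interchange (lookup e j) (lookup f j) (sumAt J e) (sumAt J f))
  }

sumAt-cong : ∀ {n} {J : List (Fin n)} {u w} → (∀ {j} → j ∈ J → lookup u j ≡ lookup w j) → sumAt J u ≡ sumAt J w
sumAt-cong {J = []}    eq = refl
sumAt-cong {J = j ∷ J} eq = cong₂ ℤ._+_ (eq (here refl)) (sumAt-cong (λ j∈ → eq (there j∈)))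

sumAt-unitV-∉ : ∀ {n} {i : Fin n} J → i ∉ J → sumAt J (unitV i) ≡ 0ℤ
sumAt-unitV-∉ []      i∉ = refl
sumAt-unitV-∉ (j ∷ J) i∉ = cong₂ ℤ._+_ (unitV-≢ (λ j≡i → i∉ (here (sym j≡i)))) (sumAt-unitV-∉ J (λ i∈ → i∉ (there i∈)))

sumAt-unitV-∈ : ∀ {n} {i : Fin n} {J} → Unique J → i ∈ J → sumAt J (unitV i) ≡ 1ℤ
sumAt-unitV-∈ {J = j ∷ J} (j∉ ∷ u) (here refl) =
  cong₂ ℤ._+_ (unitV-≡ j) (sumAt-unitV-∉ J (λ j∈ → All.lookup j∉ j∈ refl))
sumAt-unitV-∈ {J = j ∷ J} (j∉ ∷ u) (there i∈) =
  cong₂ ℤ._+_ (unitV-≢ (All.lookup j∉ i∈)) (sumAt-unitV-∈ u i∈)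

drop-sum-mono : ∀ j {μ ν} → Pointwise ℕ._≤_ μ ν → sumℕ (drop j μ) ℕ.≤ sumℕ (drop j ν)
drop-sum-mono zero    []       = ℕₚ.≤-refl
drop-sum-mono zero    (p ∷ ps) = ℕₚ.+-mono-≤ p (drop-sum-mono zero ps)
drop-sum-mono (suc j) []       = ℕₚ.≤-refl
drop-sum-mono (suc j) (p ∷ ps) = drop-sum-mono j ps

module Induction {n : ℕ} (n₀ : ℕ) (a : Vec ℕ n) (a-pos : ∀ i → 1 ℕ.≤ lookup a i) where

  open Kernel n₀ a a-pos
  open Groups n₀ a a-pos
  open RingLemmas (polyRing n)

  bonusRow : Fin n → List (Fin n) → ℤ
  bonusRow i []      = 0ℤ
  bonusRow i (j ∷ J) = ε i j ℤ.+ bonusRow i J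

  bonus : List (Fin n) → List (Fin n) → ℤ
  bonus []      J = 0ℤ
  bonus (i ∷ I) J = bonusRow i J ℤ.+ bonus I J

  -- `S` holds the indices still in the kernel, `j` counts the complete functions to be expanded and
  -- `c` is the total degree of the others. The split belongs to the exponent `u`: exponents of one
  -- polynomial may need different subsets `I`.
  record Good (S : List (Fin n)) (j c : ℕ) (u : Vec ℤ n) : Set where
    constructor good
    field
      I J : List (Fin n)
      split : I ++ J ↭ S
      size  : length I ≡ j
      ineq  : sumAt J u ℤ.+ bonus I J ℤ.≤ + c

  J⊆S : ∀ {S j c u} (g : Good S j c u) → ∀ {x} → x ∈ Good.J g → x ∈ S
  J⊆S g x∈ = Permₚ.∈-resp-↭ (Good.split g) (∈-++⁺ʳ (Good.I g) x∈)

  good-weaken : ∀ {S j c d u} → c ℕ.≤ d → Good S j c u → Good S j d u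
  good-weaken c≤d (good I J sp sz le) = good I J sp sz (ℤₚ.≤-trans le (ℤ.+≤+ c≤d))

  good-shift : ∀ {S j c u} i k → i ∉ S → Good S j c u → Good S j c (zipWith ℤ._+_ (proj₂ (letter i k)) u)
  good-shift {u = u} i k i∉ g@(good I J sp sz le) = good I J sp sz (ℤₚ.≤-trans (ℤₚ.≤-reflexive
    (cong (λ z → z ℤ.+ bonus I J) (sumAt-cong {J = J} {zipWith ℤ._+_ (proj₂ (letter i k)) u} {u} λ {j} j∈ → trans (letter-lookup i k u j)
      (trans (cong (λ z → z ℤ.+ lookup u j) (unitV-≢ {i = i} {j} λ j≡i → i∉ (subst (_∈ _) j≡i (J⊆S g j∈)))) (ℤₚ.+-identityˡ (lookup u j)))))) le)

  bonusRow-bound : ∀ i {J w} → (∀ {j} → j ∈ J → lookup w j ℤ.≤ ℤ.- ε i j) → sumAt J w ℤ.+ bonusRow i J ℤ.≤ 0ℤ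
  bonusRow-bound i {[]}        p = ℤₚ.≤-refl
  bonusRow-bound i {j ∷ J} {w} p = ℤₚ.≤-trans
    (ℤₚ.≤-reflexive (+-interchange (lookup w j) (sumAt J w) (ε i j) (bonusRow i J)))
    (ℤₚ.+-mono-≤ (ℤₚ.≤-trans (ℤₚ.+-monoˡ-≤ (ε i j) (p (here refl))) (ℤₚ.≤-reflexive (ℤₚ.+-inverseˡ (ε i j))))
      (bonusRow-bound i (λ j∈ → p (there j∈))))

  -- A multiplier with exponent at most -ε i m in every remaining x_m pays exactly for the new row
  -- of ε that appears when i joins `I`.
  good-step : ∀ {S S′ i j c w u} → S ↭ i ∷ S′ → (∀ {m} → m ∈ S′ → lookup w m ℤ.≤ ℤ.- ε i m) →
    Good S′ j c u → Good S (suc j) c (zipWith ℤ._+_ w u)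
  good-step {i = i} {c = c} {w} {u} p wb g@(good I J sp sz le) = good (i ∷ I) J
    (Perm.trans (prep i sp) (↭-sym p)) (cong suc sz)
    (ℤₚ.≤-trans (ℤₚ.≤-reflexive (trans (cong (λ z → z ℤ.+ (bonusRow i J ℤ.+ bonus I J)) (ℓ-+ (sumAt-additive J) w u))
        (+-interchange (sumAt J w) (sumAt J u) (bonusRow i J) (bonus I J))))
      (ℤₚ.≤-trans (ℤₚ.+-mono-≤ (bonusRow-bound i (λ j∈ → wb (J⊆S g j∈))) le)
        (ℤₚ.≤-reflexive (ℤₚ.+-identityˡ (+ c)))))

  unitV-≤1 : ∀ (i m : Fin n) → lookup (unitV i) m ℤ.≤ 1ℤ
  unitV-≤1 i m with m Fin.≟ i
  ... | yes refl = ℤₚ.≤-reflexive (unitV-≡ i)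
  ... | no m≢i   = ℤₚ.≤-trans (ℤₚ.≤-reflexive (unitV-≢ m≢i)) (ℤ.+≤+ ℕ.z≤n)

  unitV-≥0 : ∀ (i m : Fin n) → 0ℤ ℤ.≤ lookup (unitV i) m
  unitV-≥0 i m with m Fin.≟ i
  ... | yes refl = ℤₚ.≤-trans (ℤ.+≤+ ℕ.z≤n) (ℤₚ.≤-reflexive (sym (unitV-≡ i)))
  ... | no m≢i   = ℤₚ.≤-reflexive (sym (unitV-≢ m≢i))

  κ-bound-empty : ∀ {i j m} → b j ≡ 0 → m ≢ i → (λ e → lookup e m) ⊢ κ i j ≤ 0ℤ
  κ-bound-empty {i} {j} {m} b≡0 m≢i = bound-weaken
    (ℤₚ.≤-reflexive (cong +_ (trans (cong₂ ℕ._+_ (ℕₚ.*-zeroʳ (b i)) (cong (ℕ._* 1) b≡0)) refl)))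
    (κ-bound (lookup-additive m) i j {0} {1}
      (ℤₚ.≤-trans (ℤₚ.≤-reflexive (trans (ratio-lookup i j m)
          (trans (cong (λ z → z ℤ.- lookup (unitV j) m) (unitV-≢ m≢i)) (ℤₚ.+-identityˡ (ℤ.- lookup (unitV j) m)))))
        (ℤₚ.neg-mono-≤ (unitV-≥0 j m)))
      (ℤₚ.≤-trans (ℤₚ.≤-reflexive (trans (ratio-lookup j i m)
          (trans (cong (λ z → lookup (unitV j) m ℤ.- z) (unitV-≢ m≢i)) (ℤₚ.+-identityʳ (lookup (unitV j) m)))))
        (unitV-≤1 j m)))

  -- Since a_j ≥ 1, a group without letters has a_j = 1 and χ = 1 at j, which kills the factor 1 - χ
  -- of ε.
  ε-empty : ∀ i {j} → b j ≡ 0 → ε i j ≡ 0ℤ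
  ε-empty i {j} b≡0 = ε-zero (ℕₚ.≤-trans (χ≤1 i) (ℕₚ.≤-trans (a-pos j) (ℕₚ.m∸n≡0⇒m≤n b≡0)))

  κ-bound-zero : ∀ {ℓ} → Additive ℓ → ∀ i j → ℓ (proj₂ (ratio i j)) ℤ.≤ 0ℤ → ℓ (proj₂ (ratio j i)) ℤ.≤ 0ℤ →
    ℓ ⊢ κ i j ≤ 0ℤ
  κ-bound-zero add i j p q = bound-weaken
    (ℤₚ.≤-reflexive (cong +_ (cong₂ ℕ._+_ (ℕₚ.*-zeroʳ (b i)) (ℕₚ.*-zeroʳ (b j)))))
    (κ-bound add i j {0} {0} p q)

  sumAt-ratio : ∀ {S} {i j : Fin n} → Unique S → i ∈ S → j ∈ S → sumAt S (proj₂ (ratio i j)) ≡ 0ℤ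
  sumAt-ratio {S} {i} {j} u i∈ j∈ = trans (sumAt-cong {J = S} (λ {m} _ → eq m))
    (trans (ℓ-+ (sumAt-additive S) (unitV i) (negUnitV j))
      (cong₂ ℤ._+_ (sumAt-unitV-∈ u i∈) (trans (sumAt-neg S) (cong ℤ.-_ (sumAt-unitV-∈ u j∈)))))
    where
    eq : ∀ m → lookup (proj₂ (ratio i j)) m ≡ lookup (zipWith ℤ._+_ (unitV i) (negUnitV j)) m
    eq m = trans (ratio-lookup i j m) (sym (trans (Vecₚ.lookup-zipWith ℤ._+_ m (unitV i) (negUnitV j))
      (cong (λ z → lookup (unitV i) m ℤ.+ z) (negUnitV-lookup j m))))
    sumAt-neg : ∀ (J : List (Fin n)) → sumAt J (negUnitV j) ≡ ℤ.- sumAt J (unitV j)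
    sumAt-neg []      = refl
    sumAt-neg (m ∷ J) = trans (cong₂ ℤ._+_ (negUnitV-lookup j m) (sumAt-neg J))
      (sym (ℤₚ.neg-distrib-+ (lookup (unitV j) m) (sumAt J (unitV j))))

  -- With nothing to select, `I` is empty and the inequality concerns the total degree in the
  -- variables of `T ++ U`: the kernel has degree 0 and each letter degree 1.
  base : ∀ T U μ → Unique (T ++ U) →
    Supported (Good (T ++ U) 0 (sumℕ μ)) (hλ μ (X T) *P ∏₂ κ (T ++ U))
  base T U μ u = weaken (hλ-below add letters μ (supported-all λ t∈ → All.lookup (bound κ≤0) t∈))
    where
    S : List (Fin n)
    S = T ++ U
    add : Additive (sumAt S)
    add = sumAt-additive S
    weaken : ∀ {P} → Supported (Below (sumAt S) (+ (sumℕ μ) ℤ.+ 0ℤ)) P → Supported (Good S 0 (sumℕ μ)) P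
    weaken s .vanish f B f≡0 q = vanish s f B f≡0 λ {k} {e} le → q (good [] S Perm.refl refl
      (ℤₚ.≤-trans (ℤₚ.≤-reflexive (ℤₚ.+-identityʳ (sumAt S e)))
        (ℤₚ.≤-trans le (ℤₚ.≤-reflexive (ℤₚ.+-identityʳ (+ (sumℕ μ)))))))
    κ≤0 : sumAt S ⊢ ∏₂ κ S ≤ 0ℤ
    κ≤0 = bound-∏₂ add κ λ {i} {j} i∈ j∈ → κ-bound-zero add i j
      (ℤₚ.≤-reflexive (sumAt-ratio u i∈ j∈)) (ℤₚ.≤-reflexive (sumAt-ratio u j∈ i∈))
    letters : All (λ y → sumAt S (proj₂ y) ℤ.≤ 1ℤ) (X T)
    letters = Allₚ.concat⁺ {xss = List.map (λ i → List.map (letter i) (upTo (b i))) T}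
      (Allₚ.map⁺ (All.tabulate {xs = T} λ {i} i∈ → row i i∈))
      where
      row : ∀ i → i ∈ T → All (λ y → sumAt S (proj₂ y) ℤ.≤ 1ℤ) (List.map (letter i) (upTo (b i)))
      row i i∈ = Allₚ.map⁺ (All.tabulate λ _ → ℤₚ.≤-reflexive (trans (ℓ-+ add (unitV i) (replicate n 0ℤ))
        (cong₂ ℤ._+_ (sumAt-unitV-∈ u (∈-++⁺ˡ i∈)) (ℓ-zero add))))

  -- No letter is left to expand, yet j indices remain to be selected. The first j of `U` serve: the
  -- kernel factors among groups without letters do not involve the variables, and ε vanishes there.
  base-empty : ∀ j U μ c → All (λ i → b i ≡ 0) U → j ℕ.≤ length U →
    Supported (Good U j c) (hλ μ [] *P ∏₂ κ U)
  base-empty j U μ c empty j≤ = supported-all λ t∈ → good I J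
    (Perm.↭-reflexive (Listₚ.take++drop≡id j U))
    (trans (Listₚ.length-take j U) (ℕₚ.m≤n⇒m⊓n≡m j≤))
    (ℤₚ.≤-trans (ℤₚ.+-mono-≤ (All.lookup (bound all≤0) t∈) (ℤₚ.≤-reflexive (bonus≡0 I)))
      (ℤ.+≤+ ℕ.z≤n))
    where
    I J : List (Fin n)
    I = take j U
    J = drop j U
    add : Additive (sumAt J)
    add = sumAt-additive J
    bonusRow≡0 : ∀ i {J} → All (λ i → b i ≡ 0) J → bonusRow i J ≡ 0ℤ
    bonusRow≡0 i []       = refl
    bonusRow≡0 i (p ∷ ps) = cong₂ ℤ._+_ (ε-empty i p) (bonusRow≡0 i ps)
    bonus≡0 : ∀ I → bonus I J ≡ 0ℤ
    bonus≡0 []      = refl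
    bonus≡0 (i ∷ I) = cong₂ ℤ._+_ (bonusRow≡0 i (Allₚ.drop⁺ j empty)) (bonus≡0 I)
    -- `κ-bound` asks for some natural bound on the two ratios; its size does not matter, being
    -- multiplied by group sizes that are 0.
    abs-bound : ∀ (x : ℤ) → x ℤ.≤ + ℤ.∣ x ∣
    abs-bound (+ m)      = ℤₚ.≤-refl
    abs-bound ℤ.-[1+ m ] = ℤ.-≤+
    all≤0 : sumAt J ⊢ hλ μ [] *P ∏₂ κ U ≤ 0ℤ
    all≤0 = bound-* add (hλ-[]-bound add μ) (bound-∏₂ add κ λ {i} {k} i∈ k∈ → bound-weaken
      (ℤₚ.≤-reflexive (cong₂ (λ x y → + (x ℕ.* ℤ.∣ sumAt J (proj₂ (ratio i k)) ∣ ℕ.+ y ℕ.* ℤ.∣ sumAt J (proj₂ (ratio k i)) ∣))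
        (All.lookup empty i∈) (All.lookup empty k∈)))
      (κ-bound add i k (abs-bound _) (abs-bound _)))

  κI : Item → Item → Poly n
  κI x y = κ (proj₁ x) (proj₁ y)

  -- Items instead of monomials, because `ρ` depends on the group and the power of q of a letter and
  -- not only on its value.
  hI : ℕ → List Item → Poly n
  hI r ks = h r (List.map letterOf ks)

  hI-zero : ∀ ks → hI 0 ks ≈ oneP
  hI-zero ks = h-zero (List.map letterOf ks)

  hI-suc : ∀ r x ks → hI (suc r) (x ∷ ks) ≈ hI (suc r) ks +P (itemVal x *P hI r (x ∷ ks))
  hI-suc r x ks = h-suc r (letterOf x) (List.map letterOf ks)

  module ItemComplete = Complete {A = Item} itemVal hI hI-zero h-nil hI-suc
  module ItemLagrange = ItemComplete.Lagrange {κI} {ρ} κ-factor ρ-antisym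

  -- The multiplier of the i-th Lagrange term once the kernel of the other indices is split off.
  multiplier : ℕ → Item → List Item → List (Fin n) → Poly n
  multiplier p x rest U =
    pow (itemVal x) p *P ((groupMono (proj₁ x) *P ∏ (κ (proj₁ x)) U) *P ∏ (λ y → ρ x y *P groupMono (proj₁ y)) rest)

  -- If m is the group of an unselected letter y, then `ρ x y` has degree at most b m - 1 - ε i m in
  -- x_m and `groupMono` contributes -(b m - 1); every other factor contributes at most 0. If m is
  -- in `U`, then ε i m = 0 and only the latter remark is needed.
  multiplier-bound : ∀ p x rest U → proj₁ x ∉ List.map proj₁ rest ++ U → All (λ i → b i ≡ 0) U →
    ∀ {m} → m ∈ List.map proj₁ rest ++ U → (λ e → lookup e m) ⊢ multiplier p x rest U ≤ ℤ.- ε (proj₁ x) m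
  multiplier-bound p x@(i , k) rest U i∉ empty {m} m∈ = bound-weaken
      (ℤₚ.≤-reflexive (trans (ℤₚ.+-identityˡ _) (ℤₚ.+-identityˡ _)))
      (bound-* add (bound-pow add (bound-monoP (ℤₚ.≤-reflexive (letter-other (toℕ k)))) p)
        (bound-* add (bound-* add (bound-pow add (bound-monoP (ℤₚ.≤-reflexive (neg-other m≢i))) (b i ∸ 1))
            (bound-∏≤0 add (κ i) (λ {j} j∈ → κ-bound-empty (All.lookup empty j∈) m≢i)))
          (rest-bound (∈-++⁻ (List.map proj₁ rest) m∈))))
    where
    add : Additive (λ e → lookup e m)
    add = lookup-additive m
    m≢i : m ≢ i
    m≢i refl = i∉ m∈
    letter-other : ∀ k → lookup (proj₂ (letter i k)) m ≡ 0ℤ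
    letter-other k = trans (ℓ-+ add (unitV i) (replicate n 0ℤ)) (cong₂ ℤ._+_ (unitV-≢ m≢i) (ℓ-zero add))
    own : ∀ y → proj₁ y ≡ m → (λ e → lookup e m) ⊢ ρ x y *P groupMono (proj₁ y) ≤ ℤ.- ε i m
    own y@(j , l) refl = bound-weaken (ℤₚ.≤-reflexive (trans
        (cong (λ z → ((+ b j ℤ.- 1ℤ) ℤ.- ε i j) ℤ.+ ℤ.- z) (pred-≡ (ℕₚ.≤-trans (ℕ.s≤s ℕ.z≤n) (Finₚ.toℕ<n l))))
        (lemma (+ b j ℤ.- 1ℤ) (ε i j))))
      (bound-* add (ρ-bound x y) (bound-pow-neg add (bound-monoP (ℤₚ.≤-reflexive (neg-at j))) (b j ∸ 1)))
      where
      lemma : ∀ c e → (c ℤ.- e) ℤ.+ ℤ.- c ≡ ℤ.- e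
      lemma = ℤ-solve
    each : ∀ {y} → y ∈ rest → (λ e → lookup e m) ⊢ ρ x y *P groupMono (proj₁ y) ≤ 0ℤ
    each {y} _ with m Fin.≟ proj₁ y
    ... | yes m≡ = bound-weaken (ℤₚ.neg-mono-≤ (ε-nonneg i m)) (own y (sym m≡))
    ... | no m≢  = bound-* add (ρ-bound-other x y m≢i m≢)
      (bound-pow add (bound-monoP (ℤₚ.≤-reflexive (neg-other m≢))) (b (proj₁ y) ∸ 1))
    rest-bound : m ∈ List.map proj₁ rest ⊎ m ∈ U →
      (λ e → lookup e m) ⊢ ∏ (λ y → ρ x y *P groupMono (proj₁ y)) rest ≤ ℤ.- ε i m
    rest-bound (inj₁ m∈T) with ∈-map⁻ proj₁ m∈T
    ... | y , y∈ , m≡ = bound-∏∈ add (λ y → ρ x y *P groupMono (proj₁ y)) each y∈ (own y (sym m≡))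
    rest-bound (inj₂ m∈U) = bound-weaken (ℤₚ.≤-reflexive (sym (cong ℤ.-_ (ε-empty i (All.lookup empty m∈U)))))
      (bound-∏≤0 add (λ y → ρ x y *P groupMono (proj₁ y)) each)

  -- Indices without letters are kept apart in `U`: the expansion cannot select them, but their
  -- kernel factors have to be carried along. The entries of `drop j μ` belong to the functions that
  -- are never expanded.
  Claim : ℕ → Set
  Claim j = ∀ T U μ → Unique (T ++ U) → All (λ i → 1 ℕ.≤ b i) T → All (λ i → b i ≡ 0) U →
    j ℕ.≤ length (T ++ U) → Supported (Good (T ++ U) j (sumℕ (drop j μ))) (hλ μ (X T) *P ∏₂ κ (T ++ U))

  -- The term is a multiplier times the polynomial of the claim for the indices other than i, except
  -- that the remaining complete functions still contain the letters of group i. Peeling these off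
  -- lowers entries of `μ`, hence at most lowers the degree past position j.
  lagrange-term : ∀ {j} → Claim j → ∀ ks U μ → Unique (List.map proj₁ ks ++ U) →
    All (λ i → 1 ℕ.≤ b i) (List.map proj₁ ks) → All (λ i → b i ≡ 0) U → suc j ℕ.≤ length (List.map proj₁ ks ++ U) →
    ∀ r x rest → ks ↭ x ∷ rest →
    Supported (Good (List.map proj₁ ks ++ U) (suc j) (sumℕ (drop j μ)))
      (ItemLagrange.summand r (x , rest) *P (∏ groupMono (List.map proj₁ ks) *P (hλ μ (X (List.map proj₁ ks)) *P
        (∏ (λ i → ∏ (κ i) U) (List.map proj₁ ks) *P ∏₂ κ U))))
  lagrange-term {j} claim ks U μ u pos empty j< r x@(i , k) rest p = supported-≈ (≈-sym rearrange)
    (supported-* {P = multiplier (r ℕ.+ length rest) x rest U}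
      (λ t∈ → good-step pS (λ m∈ → All.lookup (bound (multiplier-bound (r ℕ.+ length rest) x rest U i∉ empty m∈)) t∈))
      (hλ-peel {Y = List.map (letter i) (upTo (b i))}
        (Allₚ.map⁺ (All.tabulate λ {k} _ → good-shift i k i∉)) (X T′) μ (∏₂ κ S′)
        λ {μ′} μ′≤μ → weaken (drop-sum-mono j μ′≤μ) (claim T′ U μ′ u′ pos′ empty
          (ℕₚ.≤-pred (ℕₚ.≤-trans j< (ℕₚ.≤-reflexive (Permₚ.↭-length pS)))))))
    where
    T T′ S′ : List (Fin n)
    T = List.map proj₁ ks
    T′ = List.map proj₁ rest
    S′ = T′ ++ U
    pT : T ↭ i ∷ T′
    pT = Permₚ.map⁺ proj₁ p
    pS : T ++ U ↭ i ∷ S′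
    pS = Permₚ.++⁺ʳ U pT
    uS : Unique (i ∷ S′)
    uS = unique-↭ pS u
    i∉ : i ∉ S′
    i∉ i∈ with uS
    ... | i∉S′ ∷ _ = All.lookup i∉S′ i∈ refl
    u′ : Unique S′
    u′ with uS
    ... | _ ∷ v = v
    pos′ : All (λ i → 1 ℕ.≤ b i) T′
    pos′ with Permₚ.All-resp-↭ pT pos
    ... | _ ∷ ps = ps
    weaken : ∀ {c d P} → c ℕ.≤ d → Supported (Good S′ j c) P → Supported (Good S′ j d) P
    weaken c≤d s .vanish f B f≡0 q = vanish s f B f≡0 λ g → q (good-weaken c≤d g)
    K R M W : Poly n
    K = ∏₂ κI rest
    R = ∏ (ρ x) rest
    M = ∏ (λ y → groupMono (proj₁ y)) rest
    W = ∏ (λ i → ∏ (κ i) U) T′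
    P : Poly n
    P = pow (itemVal x) (r ℕ.+ length rest)
    H : Poly n
    H = hλ μ (List.map (letter i) (upTo (b i)) ++ X T′)
    rearrange : (P *P (R *P K)) *P (∏ groupMono T *P (hλ μ (X T) *P (∏ (λ i → ∏ (κ i) U) T *P ∏₂ κ U)))
      ≈ multiplier (r ℕ.+ length rest) x rest U *P (H *P ∏₂ κ S′)
    rearrange = ≈-trans
      (*P-cong (≈-refl {P = P *P (R *P K)})
        (*P-cong (≈-trans (∏-↭ groupMono pT) (*P-cong (≈-refl {P = groupMono i}) (≈-reflexive (∏-map proj₁ groupMono rest))))
          (*P-cong (hλ-↭ (X-↭ pT) μ)
            (*P-cong (∏-↭ (λ i → ∏ (κ i) U) pT) (≈-refl {P = ∏₂ κ U})))))
      (≈-trans (*-collect P R K (groupMono i) M H (∏ (κ i) U) W (∏₂ κ U))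
        (*P-cong
          (*P-cong (≈-refl {P = P}) (*P-cong (≈-refl {P = groupMono i *P ∏ (κ i) U}) (≈-sym (∏-* (ρ x) (λ y → groupMono (proj₁ y)) rest))))
          (*P-cong (≈-refl {P = H}) (≈-sym (≈-trans (∏₂-++ κ T′ U)
            (*P-cong (≈-reflexive (∏₂-map proj₁ κ rest)) (≈-refl {P = W *P ∏₂ κ U})))))))

  step : ∀ {j} → Claim j → ∀ i T U r μ → Unique (i ∷ T ++ U) → All (λ i → 1 ℕ.≤ b i) (i ∷ T) →
    All (λ i → b i ≡ 0) U → suc j ℕ.≤ length (i ∷ T ++ U) →
    Supported (Good (i ∷ T ++ U) (suc j) (sumℕ (drop j μ)))
      (h r (X (i ∷ T)) *P (hλ μ (X (i ∷ T)) *P ∏₂ κ (i ∷ T ++ U)))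
  step {j} claim i T U r μ u pos empty j< = subst
    (λ Y → Supported Q (h r Y *P (hλ μ (X (i ∷ T)) *P ∏₂ κ (i ∷ T ++ U)))) (Listₚ.++-identityʳ (X (i ∷ T)))
    (groups-reduction (i ∷ T) pos [] _ terms r)
    where
    Q : Vec ℤ n → Set
    Q = Good (i ∷ T ++ U) (suc j) (sumℕ (drop j μ))
    terms : ∀ ks → List.map proj₁ ks ≡ i ∷ T → ∀ r →
      Supported Q (h r (List.map letterOf ks ++ []) *P (∏ groupMono (i ∷ T) *P (hλ μ (X (i ∷ T)) *P ∏₂ κ (i ∷ T ++ U))))
    terms ks@(x ∷ xs) refl r = subst
      (λ Y → Supported Q (h r Y *P (∏ groupMono (i ∷ T) *P (hλ μ (X (i ∷ T)) *P ∏₂ κ (i ∷ T ++ U)))))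
      (sym (Listₚ.++-identityʳ (List.map letterOf ks)))
      (supported-≈ (≈-sym expand) (supported-sum (λ s → ItemLagrange.summand r s *P C₀)
        (All.map (λ {s} p → lagrange-term claim ks U μ u pos empty j< r (proj₁ s) (proj₂ s) p) (selections-↭ ks))))
      where
      M H W V : Poly n
      M = ∏ groupMono (i ∷ T)
      H = hλ μ (X (i ∷ T))
      W = ∏ (λ i → ∏ (κ i) U) (i ∷ T)
      V = ∏₂ κ U
      C₀ : Poly n
      C₀ = M *P (H *P (W *P V))
      expand : hI r ks *P (M *P (H *P ∏₂ κ (i ∷ T ++ U))) ≈ ∑ (λ s → ItemLagrange.summand r s *P C₀) (selections ks)
      expand = ≈-trans
        (*P-cong (≈-refl {P = hI r ks}) (*P-cong (≈-refl {P = M}) (*P-cong (≈-refl {P = H})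
          (≈-trans (∏₂-++ κ (i ∷ T) U) (*P-cong (≈-reflexive (∏₂-map proj₁ κ ks)) (≈-refl {P = W *P V}))))))
        (≈-trans (*-regroup (hI r ks) M H (∏₂ κI ks) W V)
          (≈-trans (*P-cong (ItemLagrange.lagrange r x xs) (≈-refl {P = C₀}))
            (∑-*ʳ (ItemLagrange.summand r) C₀ (selections ks))))

  claim : ∀ j → Claim j
  claim zero    T       U μ       u pos empty j≤ = base T U μ u
  claim (suc j) []      U μ       u pos empty j≤ = base-empty (suc j) U μ _ empty j≤
  claim (suc j) (i ∷ T) U (r ∷ μ) u pos empty j≤ =
    supported-≈ (≈-sym (*P-assoc (h r (X (i ∷ T))) (hλ μ (X (i ∷ T))) (∏₂ κ (i ∷ T ++ U))))
      (step (claim j) i T U r μ u pos empty j≤)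
  -- When the complete functions run out before j indices are selected, h_0 = 1 is inserted and
  -- expanded, so that an index is selected all the same.
  claim (suc j) (i ∷ T) U []      u pos empty j≤ =
    supported-≈ (≈-trans (*P-cong (h-zero (X (i ∷ T))) (≈-refl {P = E})) (*P-identityˡ E))
      (subst (λ l → Supported (Good (i ∷ T ++ U) (suc j) (sumℕ l)) (h 0 (X (i ∷ T)) *P E))
        (Listₚ.drop-[] j) (step (claim j) i T U 0 [] u pos empty j≤))
    where
    E : Poly n
    E = oneP *P ∏₂ κ (i ∷ T ++ U)

filter-↭ : ∀ {a p} {A : Set a} {P : Pred A p} (P? : Decidable P) xs →
  xs ↭ filter P? xs ++ filter (λ x → ¬? (P? x)) xs
filter-↭ P? []       = Perm.refl
filter-↭ P? (x ∷ xs) with P? x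
... | yes _ = prep x (filter-↭ P? xs)
... | no _  = Perm.trans (prep x (filter-↭ P? xs)) (↭-sym (Permₚ.shift x (filter P? xs) _))

concatMap-cong-∈ : ∀ {a b} {A : Set a} {B : Set b} {f g : A → List B} {xs} →
  All (λ x → f x ≡ g x) xs → concatMap f xs ≡ concatMap g xs
concatMap-cong-∈ []       = refl
concatMap-cong-∈ (p ∷ ps) = cong₂ _++_ p (concatMap-cong-∈ ps)

-- Sums over indices

sum : ∀ {n} → (Fin n → ℤ) → List (Fin n) → ℤ
sum g S = List.foldr ℤ._+_ 0ℤ (List.map g S)

module _ {n : ℕ} where

  sum-cong : ∀ {g g′ : Fin n → ℤ} {S} → (∀ {i} → i ∈ S → g i ≡ g′ i) → sum g S ≡ sum g′ S
  sum-cong {S = []}    eq = refl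
  sum-cong {S = i ∷ S} eq = cong₂ ℤ._+_ (eq (here refl)) (sum-cong (λ i∈ → eq (there i∈)))

  sum-↭ : ∀ (g : Fin n → ℤ) {S S′} → S ↭ S′ → sum g S ≡ sum g S′
  sum-↭ g Perm.refl        = refl
  sum-↭ g (prep i p)       = cong (λ z → g i ℤ.+ z) (sum-↭ g p)
  sum-↭ g (swap i j p)     = trans (cong (λ z → g i ℤ.+ (g j ℤ.+ z)) (sum-↭ g p)) (lemma (g i) (g j) _)
    where
    lemma : ∀ x y z → x ℤ.+ (y ℤ.+ z) ≡ y ℤ.+ (x ℤ.+ z)
    lemma = ℤ-solve
  sum-↭ g (Perm.trans p q) = trans (sum-↭ g p) (sum-↭ g q)

  sum-++ : ∀ (g : Fin n → ℤ) S S′ → sum g (S ++ S′) ≡ sum g S ℤ.+ sum g S′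
  sum-++ g []      S′ = sym (ℤₚ.+-identityˡ _)
  sum-++ g (i ∷ S) S′ = trans (cong (λ z → g i ℤ.+ z) (sum-++ g S S′)) (sym (ℤₚ.+-assoc (g i) _ _))

  sum-zero : ∀ (S : List (Fin n)) → sum (λ _ → 0ℤ) S ≡ 0ℤ
  sum-zero []      = refl
  sum-zero (i ∷ S) = trans (ℤₚ.+-identityˡ _) (sum-zero S)

  sum-one : ∀ (S : List (Fin n)) → sum (λ _ → 1ℤ) S ≡ + length S
  sum-one []      = refl
  sum-one (i ∷ S) = cong (λ z → 1ℤ ℤ.+ z) (sum-one S)

  sum-ℕ : ∀ (g : Fin n → ℕ) S → + sumℕ (List.map g S) ≡ sum (λ i → + g i) S
  sum-ℕ g []      = refl
  sum-ℕ g (i ∷ S) = cong (λ z → + g i ℤ.+ z) (sum-ℕ g S)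

  sumAt-sum : ∀ J (u : Vec ℤ n) → sumAt J u ≡ sum (lookup u) J
  sumAt-sum []      u = refl
  sumAt-sum (j ∷ J) u = cong (λ z → lookup u j ℤ.+ z) (sumAt-sum J u)

  sum-allFin : ∀ (g : Fin n → ℤ) → sum g (allFin n) ≡ List.foldr ℤ._+_ 0ℤ (List.tabulate g)
  sum-allFin g = cong (List.foldr ℤ._+_ 0ℤ) (Listₚ.map-tabulate (λ i → i) g)

sizeℤ-sum : ∀ {n} (v : Vec ℤ n) → sizeℤ v ≡ sum (lookup v) (allFin n)
sizeℤ-sum v = trans (go v) (sym (sum-allFin (lookup v)))
  where
  go : ∀ {n} (v : Vec ℤ n) → sizeℤ v ≡ List.foldr ℤ._+_ 0ℤ (List.tabulate (lookup v))
  go []      = refl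
  go (x ∷ v) = cong (λ z → x ℤ.+ z) (go v)

card-sum : ∀ {n} (p : Subset n) → + ∣ p ∣ ≡ sum (λ i → if lookup p i then 1ℤ else 0ℤ) (allFin n)
card-sum p = trans (go p) (sym (sum-allFin (λ i → if lookup p i then 1ℤ else 0ℤ)))
  where
  go : ∀ {n} (p : Subset n) → + ∣ p ∣ ≡ List.foldr ℤ._+_ 0ℤ (List.tabulate λ i → if lookup p i then 1ℤ else 0ℤ)
  go []          = refl
  go (true ∷ p)  = cong (λ z → 1ℤ ℤ.+ z) (go p)
  go (false ∷ p) = trans (go p) (sym (ℤₚ.+-identityˡ _))

χ-sum : ∀ {n n₀} → n₀ ≤ n → sum (λ i → + χ n₀ i) (allFin n) ≡ + n₀
χ-sum {n} {n₀} n₀≤n = trans (sum-allFin {n} (λ i → + χ n₀ i)) (go n n₀ n₀≤n)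
  where
  go : ∀ n n₀ → n₀ ≤ n → List.foldr ℤ._+_ 0ℤ (List.tabulate {n = n} (λ i → + χ n₀ i)) ≡ + n₀
  go zero    zero     _             = refl
  go (suc n) zero     _             = trans (ℤₚ.+-identityˡ _) (go n zero ℕ.z≤n)
  go (suc n) (suc n₀) (ℕ.s≤s n₀≤n) = cong (λ z → 1ℤ ℤ.+ z) (go n n₀ n₀≤n)

⌊∈?⌋-lookup : ∀ {n} (i : Fin n) (p : Subset n) → ⌊ i Subsetₚ.∈? p ⌋ ≡ lookup p i
⌊∈?⌋-lookup Fin.zero    (true ∷ p)  = refl
⌊∈?⌋-lookup Fin.zero    (false ∷ p) = refl
⌊∈?⌋-lookup (Fin.suc i) (s ∷ p) with i Subsetₚ.∈? p | ⌊∈?⌋-lookup i p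
... | yes _ | eq = eq
... | no  _ | eq = eq

module _ {n : ℕ} where

  open import Data.List.Membership.DecPropositional (Fin._≟_ {n}) using (_∈?_)

  toSubset : List (Fin n) → Subset n
  toSubset I = Vec.tabulate λ i → does (i ∈? I)

  -- The sum over all indices splits along `I` and `J`, which are disjoint because their
  -- concatenation permutes a list without repetitions.
  sum-toSubset : ∀ I J → I ++ J ↭ allFin n → ∀ (g : Fin n → ℤ) →
    sum (λ i → if lookup (toSubset I) i then g i else 0ℤ) (allFin n) ≡ sum g I
  sum-toSubset I J p g = trans (sym (sum-↭ G p)) (trans (sum-++ G I J)
    (trans (cong₂ ℤ._+_ (sum-cong inI) (trans (sum-cong inJ) (sum-zero J))) (ℤₚ.+-identityʳ _)))
    where
    G : Fin n → ℤ
    G i = if lookup (toSubset I) i then g i else 0ℤ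
    disjoint : ∀ {A B : List (Fin n)} → Unique (A ++ B) → ∀ {i} → i ∈ B → i ∉ A
    disjoint {x ∷ A} (x∉ ∷ u) i∈B (here refl) = All.lookup (Allₚ.++⁻ʳ A x∉) i∈B refl
    disjoint {x ∷ A} (x∉ ∷ u) i∈B (there i∈A) = disjoint u i∈B i∈A
    inI : ∀ {i} → i ∈ I → G i ≡ g i
    inI {i} i∈ = cong (λ c → if c then g i else 0ℤ)
      (trans (Vecₚ.lookup∘tabulate (λ i → does (i ∈? I)) i) (dec-true (i ∈? I) i∈))
    inJ : ∀ {i} → i ∈ J → G i ≡ 0ℤ
    inJ {i} i∈ = cong (λ c → if c then g i else 0ℤ)
      (trans (Vecₚ.lookup∘tabulate (λ i → does (i ∈? I)) i)
        (dec-false (i ∈? I) (disjoint (unique-↭ (↭-sym p) (allFin⁺ n)) i∈)))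

  sumOver-toSubset : ∀ I J → I ++ J ↭ allFin n → ∀ v → sumOver (toSubset I) v ≡ sum (lookup v) I
  sumOver-toSubset I J p v = trans
    (sum-cong {S = allFin n} (λ {i} _ → cong (λ c → if c then lookup v i else 0ℤ) (⌊∈?⌋-lookup i (toSubset I))))
    (sum-toSubset I J p (lookup v))

  card-toSubset : ∀ I J → I ++ J ↭ allFin n → ∣ toSubset I ∣ ≡ length I
  card-toSubset I J p = ℤₚ.+-injective (trans (card-sum (toSubset I)) (trans (sum-toSubset I J p (λ _ → 1ℤ)) (sum-one I)))

  pI-toSubset : ∀ n₀ I J → I ++ J ↭ allFin n → + pI n₀ (toSubset I) ≡ sum (λ i → + χ n₀ i) I
  pI-toSubset n₀ I J p = trans (sum-ℕ _ (allFin n)) (trans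
    (sum-cong {S = allFin n} (λ {i} _ → trans (cong (λ c → + (if c then χ n₀ i else 0)) (⌊∈?⌋-lookup i (toSubset I)))
      (if-+ (lookup (toSubset I) i) (χ n₀ i))))
    (sum-toSubset I J p (λ i → + χ n₀ i)))
    where
    if-+ : ∀ c k → + (if c then k else 0) ≡ (if c then + k else 0ℤ)
    if-+ true  k = refl
    if-+ false k = refl

-- The integrand and the contradiction with the hypothesis

module Conclusion {n : ℕ} (n₀ : ℕ) (a : Vec ℕ n) (a-pos : ∀ i → 1 ≤ lookup a i) where

  open Kernel n₀ a a-pos
  open Groups n₀ a a-pos
  open Induction n₀ a a-pos
  open RingLemmas (polyRing n)

  entry : Fin n → Fin n → List (Poly n)
  entry i j = if toℕ i <ᵇ toℕ j then pairKernel i j ∷ [] else []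

  entry-< : ∀ {i j} → toℕ i < toℕ j → entry i j ≡ pairKernel i j ∷ []
  entry-< {i} {j} i<j with toℕ i <ᵇ toℕ j in eq
  ... | true  = refl
  ... | false = ⊥-elim (subst Bool.T eq (ℕₚ.<⇒<ᵇ i<j))

  entry-≥ : ∀ {i j} → toℕ j ≤ toℕ i → entry i j ≡ []
  entry-≥ {i} {j} j≤i with toℕ i <ᵇ toℕ j in eq
  ... | true  = ⊥-elim (ℕₚ.<⇒≱ (ℕₚ.<ᵇ⇒< (toℕ i) (toℕ j) (subst Bool.T (sym eq) tt)) j≤i)
  ... | false = refl

  pairs : List (Fin n) → List (Poly n)
  pairs []      = []
  pairs (i ∷ S) = List.map (pairKernel i) S ++ pairs S

  Sorted : List (Fin n) → Set
  Sorted = AllPairs (λ i j → toℕ i < toℕ j)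

  entries-pairs : ∀ {S} → Sorted S → concatMap (λ i → concatMap (entry i) S) S ≡ pairs S
  entries-pairs []                   = refl
  entries-pairs {i ∷ S} (i< ∷ sorted) = cong₂ _++_
    (trans (cong (_++ concatMap (entry i) S) (entry-≥ {i} {i} ℕₚ.≤-refl)) (row S i<))
    (trans (concatMap-cong-∈ (All.map (λ {j} i<j → cong (_++ concatMap (entry j) S) (entry-≥ {j} {i} (ℕₚ.<⇒≤ i<j))) i<))
      (entries-pairs sorted))
    where
    row : ∀ S → All (λ j → toℕ i < toℕ j) S → concatMap (entry i) S ≡ List.map (pairKernel i) S
    row []      []         = refl
    row (j ∷ S) (i<j ∷ ps) = cong₂ _++_ (entry-< i<j) (row S ps)

  κ-< : ∀ {i j} → toℕ i < toℕ j → κ i j ≡ monoP (qpow (B i j)) *P pairKernel i j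
  κ-< {i} {j} i<j with ℕₚ.<-cmp (toℕ i) (toℕ j)
  ... | tri< _ _ _   = refl
  ... | tri≈ i≮j _ _ = contradiction i<j i≮j
  ... | tri> i≮j _ _ = contradiction i<j i≮j

  prodP-++ : ∀ (Ps Qs : List (Poly n)) → prodP (Ps ++ Qs) ≈ prodP Ps *P prodP Qs
  prodP-++ []       Qs = ≈-sym (*P-identityˡ (prodP Qs))
  prodP-++ (P ∷ Ps) Qs = ≈-trans (*P-cong (≈-refl {P = P}) (prodP-++ Ps Qs)) (≈-sym (*P-assoc P (prodP Ps) (prodP Qs)))

  qpow-collect : ∀ c d P Q → (monoP (qpow c) *P P) *P (monoP (qpow d) *P Q) ≈ monoP (qpow (c ℕ.+ d)) *P (P *P Q)
  qpow-collect c d P Q = ≈-trans (*-interchange (monoP (qpow c)) P (monoP (qpow d)) Q)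
    (*P-cong (≈-reflexive (cong (λ e → monoP (c ℕ.+ d , e)) (0+ (replicate n 0ℤ)))) (≈-refl {P = P *P Q}))

  κ-row : ∀ i {S} → All (λ j → toℕ i < toℕ j) S →
    ∃[ N ] ∏ (κ i) S ≈ monoP (qpow N) *P prodP (List.map (pairKernel i) S)
  κ-row i []               = 0 , ≈-sym (*P-identityˡ oneP)
  κ-row i {j ∷ S} (i<j ∷ ps) with κ-row i ps
  ... | N , eq = B i j ℕ.+ N , ≈-trans (*P-cong (≈-reflexive (κ-< i<j)) eq)
    (qpow-collect (B i j) N (pairKernel i j) (prodP (List.map (pairKernel i) S)))

  κ-pairs : ∀ {S} → Sorted S → ∃[ N ] ∏₂ κ S ≈ monoP (qpow N) *P prodP (pairs S)
  κ-pairs []                    = 0 , ≈-sym (*P-identityˡ oneP)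
  κ-pairs {i ∷ S} (i< ∷ sorted) with κ-row i i< | κ-pairs sorted
  ... | M , eq₁ | N , eq₂ = M ℕ.+ N , ≈-trans (*P-cong eq₁ eq₂)
    (≈-trans (qpow-collect M N (prodP (List.map (pairKernel i) S)) (prodP (pairs S)))
      (*P-cong (≈-refl {P = monoP (qpow (M ℕ.+ N))}) (≈-sym (prodP-++ (List.map (pairKernel i) S) (pairs S)))))

  -- The scalings of the pairs accumulate to one power of q. Its exponent need not be known, since
  -- `q-cancel` removes any power.
  κ-kernel : ∃[ N ] ∏₂ κ (allFin n) ≈ monoP (qpow N) *P kernel n₀ a
  κ-kernel with κ-pairs sorted
    where
    sorted : Sorted (allFin n)
    sorted = AllPairsₚ.tabulate⁺-< (λ i<j → i<j)
  ... | N , eq = N , ≈-trans eq (≈-reflexive (cong (λ Ps → monoP (qpow N) *P prodP Ps)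
          (sym (entries-pairs (AllPairsₚ.tabulate⁺-< (λ i<j → i<j))))))

  -- The claim wants the indices sorted into those with and those without letters. This merely
  -- permutes the alphabet, and the product of `κ` over pairs is symmetric.
  integrand-supported : ∀ j λs → j ≤ n →
    Supported (Good (allFin n) j (sumℕ (drop j λs))) (integrand n₀ a λs)
  integrand-supported j λs j≤n = q-cancel (proj₁ κ-kernel) (supported-≈
      (≈-trans (*P-cong (hλ-↭ XT↭ λs) (≈-trans (∏₂-↭ κ-sym (↭-sym perm)) (proj₂ κ-kernel)))
        (*-swap (hλ λs (alphabet n₀ a)) (monoP (qpow (proj₁ κ-kernel))) (kernel n₀ a)))
      (weaken (claim j Ts Us λs (unique-↭ perm (allFin⁺ n)) (Allₚ.all-filter nonempty? (allFin n))
        (All.map (λ 1≰b → ℕₚ.n<1⇒n≡0 (ℕₚ.≰⇒> 1≰b)) (Allₚ.all-filter (λ i → ¬? (nonempty? i)) (allFin n)))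
        (ℕₚ.≤-trans j≤n (ℕₚ.≤-reflexive (trans (sym (Listₚ.length-tabulate (λ (i : Fin n) → i))) (Permₚ.↭-length perm)))))))
    where
    nonempty? : Decidable (λ i → 1 ≤ b i)
    nonempty? i = 1 ℕ.≤? b i
    Ts Us : List (Fin n)
    Ts = filter nonempty? (allFin n)
    Us = filter (λ i → ¬? (nonempty? i)) (allFin n)
    perm : allFin n ↭ Ts ++ Us
    perm = filter-↭ nonempty? (allFin n)
    X-empty : ∀ {U} → All (λ i → ¬ 1 ≤ b i) U → X U ≡ []
    X-empty []              = refl
    X-empty {i ∷ U} (p ∷ ps) = cong₂ (λ c Y → List.map (letter i) (upTo c) ++ Y) (ℕₚ.n<1⇒n≡0 (ℕₚ.≰⇒> p)) (X-empty ps)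
    XT↭ : X Ts ↭ alphabet n₀ a
    XT↭ = Perm.trans (Perm.↭-reflexive (trans (sym (Listₚ.++-identityʳ (X Ts)))
        (trans (cong (X Ts ++_) (sym (X-empty (Allₚ.all-filter (λ i → ¬? (nonempty? i)) (allFin n)))))
          (sym (Listₚ.concatMap-++ _ Ts Us)))))
      (X-↭ (↭-sym perm))
    weaken : ∀ {c P} → Supported (Good (Ts ++ Us) j c) P → Supported (Good (allFin n) j c) P
    weaken s .vanish f B f≡0 q = vanish s f B f≡0 λ { (good I J sp sz le) → q (good I J (Perm.trans sp (↭-sym perm)) sz le) }

  -- As ε i k = χ i (1 - χ k), the double sum factors into p_I and the number of indices of `J`
  -- beyond n₀.
  bonus-product : ∀ I J → bonus I J ≡ sum (λ i → + χ n₀ i) I ℤ.* (+ length J ℤ.- sum (λ i → + χ n₀ i) J)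
  bonus-product []      J = refl
  bonus-product (i ∷ I) J = trans (cong₂ ℤ._+_ (row J) (bonus-product I J))
    (sym (ℤₚ.*-distribʳ-+ (+ length J ℤ.- sum (λ i → + χ n₀ i) J) (+ χ n₀ i) (sum (λ i → + χ n₀ i) I)))
    where
    lemma : ∀ x y l s → x ℤ.* (1ℤ ℤ.- y) ℤ.+ x ℤ.* (l ℤ.- s) ≡ x ℤ.* ((1ℤ ℤ.+ l) ℤ.- (y ℤ.+ s))
    lemma = ℤ-solve
    row : ∀ J → bonusRow i J ≡ + χ n₀ i ℤ.* (+ length J ℤ.- sum (λ i → + χ n₀ i) J)
    row []      = sym (ℤₚ.*-zeroʳ (+ χ n₀ i))
    row (j ∷ J) = trans (cong (λ z → ε i j ℤ.+ z) (row J)) 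
      (lemma (+ χ n₀ i) (+ χ n₀ j) (+ length J) (sum (λ i → + χ n₀ i) J))

  -- The hypothesis for `I` and the inequality for its complement contain the same product with
  -- opposite signs. Adding them would give |v| < |λ|, against |v| = |λ|.
  good-subset : ∀ {j v} λs → n₀ ≤ n → + sizeℕ λs ≡ sizeℤ v → Good (allFin n) j (sumℕ (drop j λs)) v →
    ∃[ I ] ∣ I ∣ ≡ j ×
      ¬ (sumOver I v - (+ (pI n₀ I)) * ((+ n - + n₀ - + j) +ℤ + (pI n₀ I)) <ℤ + (partialSum j λs))
  good-subset {j} {v} λs n₀≤n size≡ (good I J sp sz le) =
    toSubset I , trans (card-toSubset I J sp) sz , λ lt → ℤₚ.<-irrefl total
      (ℤₚ.<-≤-trans (ℤₚ.+-mono-<-≤ (subst (ℤ._< + partialSum j λs) rewriteI lt) (subst (ℤ._≤ + sumℕ (drop j λs)) rewriteJ le))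
        ℤₚ.≤-refl)
    where
    VI VJ PI PJ LJ D : ℤ
    VI = sum (lookup v) I
    VJ = sum (lookup v) J
    PI = sum (λ i → + χ n₀ i) I
    PJ = sum (λ i → + χ n₀ i) J
    LJ = + length J
    D = PI ℤ.* (LJ ℤ.- PJ)
    count : + n ≡ + j ℤ.+ LJ
    count = trans (cong +_ (trans (sym (Listₚ.length-tabulate (λ (i : Fin n) → i))) (trans (sym (Permₚ.↭-length sp))
      (trans (Listₚ.length-++ I) (cong (ℕ._+ length J) sz))))) refl
    small : + n₀ ≡ PI ℤ.+ PJ
    small = trans (sym (χ-sum {n} n₀≤n)) (trans (sym (sum-↭ (λ i → + χ n₀ i) sp)) (sum-++ (λ i → + χ n₀ i) I J))
    lemma₁ : ∀ V P Q j l → V ℤ.- P ℤ.* ((((j ℤ.+ l) ℤ.- (P ℤ.+ Q)) ℤ.- j) ℤ.+ P) ≡ V ℤ.- P ℤ.* (l ℤ.- Q)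
    lemma₁ = ℤ-solve
    rewriteI : sumOver (toSubset I) v - (+ (pI n₀ (toSubset I))) * ((+ n - + n₀ - + j) +ℤ + (pI n₀ (toSubset I)))
      ≡ VI ℤ.- D
    rewriteI = trans (cong₂ (λ V P → V - P * ((+ n - + n₀ - + j) +ℤ P)) (sumOver-toSubset I J sp v) (pI-toSubset n₀ I J sp))
      (trans (cong₂ (λ N M → VI - PI * ((N - M - + j) +ℤ PI)) count small) (lemma₁ VI PI PJ (+ j) LJ))
    rewriteJ : sumAt J v ℤ.+ bonus I J ≡ VJ ℤ.+ D
    rewriteJ = cong₂ ℤ._+_ (sumAt-sum J v) (bonus-product I J)
    lemma₂ : ∀ x y d → (x ℤ.- d) ℤ.+ (y ℤ.+ d) ≡ x ℤ.+ y
    lemma₂ = ℤ-solve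
    total : (VI ℤ.- D) ℤ.+ (VJ ℤ.+ D) ≡ + partialSum j λs ℤ.+ + sumℕ (drop j λs)
    total = trans (lemma₂ VI VJ D) (trans (sym (sum-++ (lookup v) I J)) (trans (sum-↭ (lookup v) sp)
      (trans (sym (sizeℤ-sum v)) (trans (sym size≡)
        (cong +_ (trans (cong sumℕ (sym (Listₚ.take++drop≡id j λs))) (ListActionₚ.sum-++ (take j λs) (drop j λs))))))))

  coeff-zero : ∀ {Q : Vec ℤ n → Set} {P : Poly n} v → Supported Q P → ¬ Q v → ∀ m → coeff m v P ≡ 0ℤ
  coeff-zero {Q} {P} v s ¬Qv m = trans (coeff-eval m v P)
    -- Extraction of the coefficient of q^m x^v vanishes from q-degree m + 1 on, and on all
    -- exponents other than v.
    (vanish s (δ (m , v)) (suc m) (λ {k} {e} m<k → large k e m<k) (λ {k} {e} Qe → outside k e Qe))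
    where
    large : ∀ k e → suc m ≤ k → δ (m , v) (k , e) ≡ 0ℤ
    large k e m<k with m ℕ.≟ k | Vecₚ.≡-dec ℤ._≟_ v e
    ... | yes m≡k | yes _ = contradiction m≡k (ℕₚ.<⇒≢ m<k)
    ... | yes _   | no _  = refl
    ... | no _    | _     = refl
    outside : ∀ k e → Q e → δ (m , v) (k , e) ≡ 0ℤ
    outside k e Qe with m ℕ.≟ k | Vecₚ.≡-dec ℤ._≟_ v e
    ... | yes _ | yes refl = contradiction Qe ¬Qv
    ... | yes _ | no _     = refl
    ... | no _  | _        = refl

theorem1p1 : (n n₀ : ℕ) → 1 ≤ n → n₀ ≤ n →
    (a : Vec ℕ n) → (∀ i → 1 ≤ Data.Vec.lookup a i) →
    (v : Vec ℤ n) → (λs : List ℕ) → IsPartition λs →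
    + (sizeℕ λs) ≡ sizeℤ v →
    (Σ ℕ λ j → (0 < j × j < n) ×
    ((I : Subset n) → ∣ I ∣ ≡ j →
    sumOver I v - (+ (pI n₀ I)) * ((+ n - + n₀ - + j) +ℤ + (pI n₀ I))
    <ℤ + (partialSum j λs))) →
    DVanishes n₀ a v λs
theorem1p1 n n₀ _ n₀≤n a a-pos v λs _ size≡ (j , (_ , j<n) , hyp) =
  coeff-zero {Good (allFin n) j (sumℕ (drop j λs))} {integrand n₀ a λs} v (integrand-supported j λs (ℕₚ.<⇒≤ j<n)) not-good
  where
  open Conclusion n₀ a a-pos
  open Induction n₀ a a-pos using (Good)
  not-good : ¬ Good (allFin n) j (sumℕ (drop j λs)) v
  not-good g with good-subset λs n₀≤n size≡ g
  ... | I , card , not-small = not-small (hyp I card)
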